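{- Let $T=(V,E)$ be a tournament on $n$ vertices, and let $c(T,5)$ be the number of directed 5-cycles in $T$. Then $$c(T,5) = \frac{3}{4}\binom{n}{5} - \frac{1}{8}\sum_{(u,v)\in E} \left[(C+D)(A-B)^2 + (A+B)(C-D)^2\right] + \frac{1}{4}\sum_{(u,v)\in E} (A+B)(C+D),$$ where, inside each sum, $A=A(u,v)$, $B=B(u,v)$, $C=C(u,v)$, $D=D(u,v)$ are the edge scores of the edge $(u,v)$.
   Context: A tournament $T=(V,E)$ on $n$ vertices (an $n$-tournament) is a directed graph with $|V|=n$, without loops, such that for every pair of distinct vertices $u,v$ exactly one of $(u,v),(v,u)$ lies in $E$. The quantity $c(T,k)$ is the number of directed $k$-cycles of $T$, counted as subgraphs (i.e. cyclic rotations of the same vertex sequence give the same cycle). For an edge $(u,v)\in E$ the edge scores are: $A(u,v) = |\{w\in V\setminus\{u,v\} : (u,w)\in E \text{ and } (v,w)\in E\}|$; $B(u,v) = |\{w\in V\setminus\{u,v\} : (w,u)\in E \text{ and } (w,v)\in E\}|$; $C(u,v) = |\{w\in V\setminus\{u,v\} : (u,w)\in E \text{ and } (w,v)\in E\}|$; $D(u,v) = |\{w\in V\setminus\{u,v\} : (w,u)\in E \text{ and } (v,w)\in E\}|$. -}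

module Defs where

open import Data.Fin.Base using (Fin)
open import Data.Fin.Properties using (_≟_)
open import Data.Integer.Base using (ℤ; 0ℤ) renaming (_+_ to _+ℤ_)
open import Data.List.Base as List using (List; length; filter; map; foldr; allFin; cartesianProduct; cartesianProductWith; deduplicate)
import Data.List.Membership.DecPropositional as DecMembership
open import Data.List.Membership.Propositional using (_∈_)
open import Data.Nat.Base using (ℕ; zero; suc)
open import Data.Product.Base using (_×_; uncurry)
open import Data.Vec.Base using (Vec; []; _∷_; _∷ʳ_)
open import Data.Vec.Properties using (≡-dec)
open import Data.Vec.Relation.Binary.Pointwise.Inductive as Pointwise using (Pointwise)
open import Data.Vec.Relation.Unary.AllPairs using (allPairs?)
open import Data.Vec.Relation.Unary.Unique.Propositional using (Unique)
open import Level using (0ℓ)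
open import Relation.Binary.Core using (Rel)
open import Relation.Binary.Consequences using (tri⇒dec<)
open import Relation.Binary.Definitions using (Decidable; Trichotomous)
open import Relation.Binary.PropositionalEquality.Core using (_≡_)
open import Relation.Nullary.Decidable using (¬?; _×-dec_)
import Relation.Unary as U

-- Trichotomy says that exactly one of E u v, u ≡ v, E v u holds: there are no
-- loops, and distinct vertices are joined by exactly one of the two arcs.
record Tournament (n : ℕ) : Set₁ where
  field
    E       : Rel (Fin n) 0ℓ
    compare : Trichotomous _≡_ E

  E? : Decidable E
  E? = tri⇒dec< compare

rotate : ∀ {a} {X : Set a} {k} → Vec X k → Vec X k
rotate []       = []
rotate (x ∷ xs) = xs ∷ʳ x

sequences : ∀ {a} {X : Set a} → List X → (k : ℕ) → List (Vec X k)
sequences xs zero    = List.[ [] ]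
sequences xs (suc k) = cartesianProductWith _∷_ xs (sequences xs k)

SameCycle : ∀ {n k} → Rel (Vec (Fin n) k) 0ℓ
SameCycle {k = k} v w = w ∈ List.iterate rotate v k

sameCycle? : ∀ {n k} → Decidable (SameCycle {n} {k})
sameCycle? {k = k} v w = w ∈? List.iterate rotate v k
  where open DecMembership (≡-dec _≟_) using (_∈?_)

module _ {n : ℕ} (T : Tournament n) where
  open Tournament T

  -- Comparing v with rotate v entrywise demands an arc from each vertex of the
  -- sequence to the next one, and from the last vertex back to the first.
  IsCycle : ∀ {k} → Vec (Fin n) k → Set
  IsCycle v = Unique v × Pointwise E v (rotate v)

  isCycle? : ∀ {k} → U.Decidable (IsCycle {k})
  isCycle? v = allPairs? (λ x y → ¬? (x ≟ y)) v ×-dec Pointwise.decidable E? v (rotate v)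

  -- The number of directed k-cycles as subgraphs (k ≥ 1): one representative
  -- is kept from each class of vertex sequences up to rotation.
  c : ℕ → ℕ
  c k = length (deduplicate sameCycle? (filter isCycle? (sequences (allFin n) k)))

  scoreA scoreB scoreC scoreD : Fin n → Fin n → ℕ
  scoreA u v = length (filter (λ w → ¬? (w ≟ u) ×-dec ¬? (w ≟ v) ×-dec E? u w ×-dec E? v w) (allFin n))
  scoreB u v = length (filter (λ w → ¬? (w ≟ u) ×-dec ¬? (w ≟ v) ×-dec E? w u ×-dec E? w v) (allFin n))
  scoreC u v = length (filter (λ w → ¬? (w ≟ u) ×-dec ¬? (w ≟ v) ×-dec E? u w ×-dec E? w v) (allFin n))
  scoreD u v = length (filter (λ w → ¬? (w ≟ u) ×-dec ¬? (w ≟ v) ×-dec E? w u ×-dec E? v w) (allFin n))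

  edges : List (Fin n × Fin n)
  edges = filter (uncurry E?) (cartesianProduct (allFin n) (allFin n))

  ∑edges : (Fin n → Fin n → ℤ) → ℤ
  ∑edges f = foldr _+ℤ_ 0ℤ (map (uncurry f) edges)

{-# OPTIONS --safe #-}
-- Put s u v = ±1 according to the direction of the arc between u and v, so that
-- "u → v" has indicator (1 + s u v) / 2. Expanding the product of the five
-- indicators along a cyclic sequence and summing over sequences of distinct
-- vertices, the terms of odd degree cancel under reflection of the sequence and
-- the products s a b · s c d cancel under exchanging a and b; what remains is
-- n(n-1)(n-2)(n-3)(n-4) + 5 (P₂ + P₄), where P₂ sums s a b · s b c and P₄ sums
-- s a b · s b c · s c d · s d e. On the other side A ± B and C ± D are half the
-- sums over w of 1 ± s u w · s v w and s u w ± s v w. In the cubic expression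
-- the terms with coinciding w's add up to 2 (A + B) (C + D), which the quadratic
-- correction removes, and the remaining terms over distinct vertices are again
-- multiples of P₂ and P₄.
module Submission where

open import Defs
open import Data.Bool.Base using (true; false; if_then_else_)
open import Data.Fin.Base using (Fin)
open import Data.Fin.Patterns using (0F; 1F; 2F)
open import Data.Fin.Properties using (_≟_; all?)
open import Data.Integer.Base using (+_; _^_) renaming (_+_ to _+ℤ_; _-_ to _-ℤ_; _*_ to _*ℤ_)
open import Data.Integer.Properties using () renaming (_≟_ to _≟ᶻ_)
open import Data.List.Base as List using (List; []; _∷_; _++_; foldr; map; filter; length; allFin; cartesianProduct; cartesianProductWith; deduplicate)
import Data.List.Membership.DecPropositional as DecMembership
open import Data.List.Membership.Propositional using (_∈_; _∉_)
open import Data.List.Membership.Propositional.Properties using (∈-filter⁺; ∈-filter⁻; ∈-allFin; ∈-cartesianProductWith⁺)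
open import Data.List.Properties using (length-tabulate)
open import Data.List.Relation.Unary.All as All using ([]; _∷_)
open import Data.List.Relation.Unary.AllPairs as AllPairs using ([]; _∷_)
import Data.List.Relation.Unary.AllPairs.Properties as AllPairs
open import Data.List.Relation.Unary.Any using (here; there)
open import Data.List.Relation.Unary.Unique.Propositional using () renaming (Unique to Uniqueᴸ)
import Data.List.Relation.Unary.Unique.Propositional.Properties as Uniqueᴸ
open import Data.Nat.Base as ℕ using (ℕ; zero; suc; _!)
open import Data.Nat.Combinatorics using (nCk+nC[k+1]≡[n+1]C[k+1]) renaming (_C_ to _choose_)
open import Data.Product.Base using (_,_; uncurry; proj₁; proj₂)
open import Data.Rational.Base as ℚ using (_/_; toℚᵘ)
open import Data.Rational.Properties using (toℚᵘ-injective; toℚᵘ-fromℚᵘ; toℚᵘ-homo-+; toℚᵘ-homo-*; toℚᵘ-homo‿-)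
open import Data.Rational.Unnormalised.Base as ℚᵘ using (mkℚᵘ; _≃_; *≡*)
open import Data.Rational.Unnormalised.Properties as ℚᵘ using (≃-sym; ≃-trans)
open import Data.Vec.Base using (Vec; []; _∷_; head)
open import Data.Vec.Properties using (≡-dec; ∷-injective)
open import Data.Vec.Relation.Binary.Pointwise.Inductive as Pointwise using ([]; _∷_)
import Data.Vec.Relation.Unary.All as Allⱽ
open import Data.Vec.Relation.Unary.AllPairs as AllPairsⱽ using ([]; _∷_)
open import Data.Vec.Relation.Unary.Unique.Propositional using (Unique)
open import Function.Base using (_∘_; id)
open import Relation.Binary.Definitions using (Decidable; DecidableEquality; Symmetric; Transitive; Tri; tri<; tri≈; tri>)
open import Relation.Binary.PropositionalEquality
open import Relation.Nullary using (¬_; Dec; yes; no; contradiction)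
open import Relation.Nullary.Decidable using (True; toWitness; ¬?; _×-dec_; does)
import Relation.Unary as U

module IntegerIdentity where

  open import Algebra.Properties.CommutativeSemigroup using (interchange; x∙yz≈y∙xz)
  open import Data.Integer.Base using (ℤ; 0ℤ; 1ℤ; -1ℤ; _+_; _-_; _*_; -_)
  open import Data.Integer.Properties hiding (_≟_)
  open import Data.Integer.Tactic.RingSolver using (solve-∀)
  open ≡-Reasoning

  *-exchange : ∀ i j k → i * (j * k) ≡ j * (i * k)
  *-exchange = x∙yz≈y∙xz *-commutativeSemigroup

  double : ∀ i → + 2 * i ≡ i + i
  double = solve-∀

  -- Integer indicators of decidable propositions

  𝟙 : ∀ {p} {P : Set p} → Dec P → ℤ
  𝟙 p? = if does p? then 1ℤ else 0ℤ

  𝟙-yes : ∀ {p} {P : Set p} (p? : Dec P) → P → 𝟙 p? ≡ 1ℤ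
  𝟙-yes (yes _) _ = refl
  𝟙-yes (no ¬p) p = contradiction p ¬p

  𝟙-no : ∀ {p} {P : Set p} (p? : Dec P) → ¬ P → 𝟙 p? ≡ 0ℤ
  𝟙-no (yes p) ¬p = contradiction p ¬p
  𝟙-no (no _)  _  = refl

  𝟙-⇔ : ∀ {p q} {P : Set p} {Q : Set q} (p? : Dec P) (q? : Dec Q) →
        (P → Q) → (Q → P) → 𝟙 p? ≡ 𝟙 q?
  𝟙-⇔ (yes p) q? P⇒Q _   = sym (𝟙-yes q? (P⇒Q p))
  𝟙-⇔ (no ¬p) q? _   Q⇒P = sym (𝟙-no q? (¬p ∘ Q⇒P))

  𝟙-× : ∀ {p q} {P : Set p} {Q : Set q} (p? : Dec P) (q? : Dec Q) →
        𝟙 (p? ×-dec q?) ≡ 𝟙 p? * 𝟙 q?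
  𝟙-× (yes _) (yes _) = refl
  𝟙-× (yes _) (no _)  = refl
  𝟙-× (no _)  q?      = refl

  𝟙-¬ : ∀ {p} {P : Set p} (p? : Dec P) → 𝟙 (¬? p?) ≡ 1ℤ - 𝟙 p?
  𝟙-¬ (yes _) = refl
  𝟙-¬ (no _)  = refl

  -- Sums over lists

  module _ {a} {X : Set a} where

    ∑ : List X → (X → ℤ) → ℤ
    ∑ xs f = foldr _+_ 0ℤ (map f xs)

    ∑-cong-∈ : ∀ xs {f g : X → ℤ} → (∀ {x} → x ∈ xs → f x ≡ g x) → ∑ xs f ≡ ∑ xs g
    ∑-cong-∈ []       f≗g = refl
    ∑-cong-∈ (x ∷ xs) f≗g = cong₂ _+_ (f≗g (here refl)) (∑-cong-∈ xs (f≗g ∘ there))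

    ∑-cong : ∀ xs {f g : X → ℤ} → (∀ x → f x ≡ g x) → ∑ xs f ≡ ∑ xs g
    ∑-cong xs f≗g = ∑-cong-∈ xs (λ {x} _ → f≗g x)

    ∑-zero : ∀ xs → ∑ xs (λ _ → 0ℤ) ≡ 0ℤ
    ∑-zero []       = refl
    ∑-zero (x ∷ xs) = trans (+-identityˡ _) (∑-zero xs)

    ∑-+ : ∀ xs (f g : X → ℤ) → ∑ xs (λ x → f x + g x) ≡ ∑ xs f + ∑ xs g
    ∑-+ []       f g = refl
    ∑-+ (x ∷ xs) f g = trans (cong (_+_ (f x + g x)) (∑-+ xs f g)) (interchange +-commutativeSemigroup (f x) (g x) (∑ xs f) (∑ xs g))

    ∑-*ˡ : ∀ xs k (f : X → ℤ) → ∑ xs (λ x → k * f x) ≡ k * ∑ xs f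
    ∑-*ˡ []       k f = sym (*-zeroʳ k)
    ∑-*ˡ (x ∷ xs) k f = trans (cong (_+_ (k * f x)) (∑-*ˡ xs k f)) (sym (*-distribˡ-+ k _ _))

    ∑-*ʳ : ∀ xs k (f : X → ℤ) → ∑ xs (λ x → f x * k) ≡ ∑ xs f * k
    ∑-*ʳ xs k f = begin
      ∑ xs (λ x → f x * k)  ≡⟨ ∑-cong xs (λ x → *-comm (f x) k) ⟩
      ∑ xs (λ x → k * f x)  ≡⟨ ∑-*ˡ xs k f ⟩
      k * ∑ xs f            ≡⟨ *-comm k _ ⟩
      ∑ xs f * k            ∎

    ∑-- : ∀ xs (f g : X → ℤ) → ∑ xs (λ x → f x - g x) ≡ ∑ xs f - ∑ xs g
    ∑-- xs f g = begin
      ∑ xs (λ x → f x - g x)                ≡⟨ ∑-cong xs (λ x → minus (f x) (g x)) ⟩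
      ∑ xs (λ x → f x + -1ℤ * g x)          ≡⟨ ∑-+ xs f _ ⟩
      ∑ xs f + ∑ xs (λ x → -1ℤ * g x)       ≡⟨ cong (_+_ (∑ xs f)) (∑-*ˡ xs -1ℤ g) ⟩
      ∑ xs f + -1ℤ * ∑ xs g                 ≡⟨ minus (∑ xs f) (∑ xs g) ⟨
      ∑ xs f - ∑ xs g                       ∎
      where
      minus : ∀ i j → i - j ≡ i + -1ℤ * j
      minus i j = cong (_+_ i) (sym (-1*i≡-i j))

    ∑-++ : ∀ xs ys (f : X → ℤ) → ∑ (xs ++ ys) f ≡ ∑ xs f + ∑ ys f
    ∑-++ []       ys f = sym (+-identityˡ _)
    ∑-++ (x ∷ xs) ys f = trans (cong (_+_ (f x)) (∑-++ xs ys f)) (sym (+-assoc (f x) _ _))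

    ∑-const-1 : ∀ xs → ∑ xs (λ _ → 1ℤ) ≡ + length xs
    ∑-const-1 []       = refl
    ∑-const-1 (x ∷ xs) = cong (_+_ 1ℤ) (∑-const-1 xs)

    ∑-filter : ∀ {p} {P : U.Pred X p} (P? : U.Decidable P) xs (f : X → ℤ) →
               ∑ (filter P? xs) f ≡ ∑ xs (λ x → 𝟙 (P? x) * f x)
    ∑-filter P? []       f = refl
    ∑-filter P? (x ∷ xs) f with does (P? x)
    ... | true  = cong₂ _+_ (sym (*-identityˡ (f x))) (∑-filter P? xs f)
    ... | false = trans (∑-filter P? xs f) (sym (+-identityˡ _))

    length-filter : ∀ {p} {P : U.Pred X p} (P? : U.Decidable P) xs →
                    + length (filter P? xs) ≡ ∑ xs (𝟙 ∘ P?)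
    length-filter P? xs = begin
      + length (filter P? xs)       ≡⟨ ∑-const-1 (filter P? xs) ⟨
      ∑ (filter P? xs) (λ _ → 1ℤ)   ≡⟨ ∑-filter P? xs _ ⟩
      ∑ xs (λ x → 𝟙 (P? x) * 1ℤ)    ≡⟨ ∑-cong xs (λ x → *-identityʳ _) ⟩
      ∑ xs (𝟙 ∘ P?)                 ∎

    module _ (_≈?_ : DecidableEquality X) where

      ∑-pick-∉ : ∀ {x xs} (f : X → ℤ) → x ∉ xs → ∑ xs (λ y → 𝟙 (x ≈? y) * f y) ≡ 0ℤ
      ∑-pick-∉ {x} {xs} f x∉xs = trans
        (∑-cong-∈ xs λ {y} y∈xs → cong (_* f y) (𝟙-no (x ≈? y) λ { refl → x∉xs y∈xs }))
        (∑-zero xs)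

      ∑-pick : ∀ {x xs} (f : X → ℤ) → Uniqueᴸ xs → x ∈ xs →
               ∑ xs (λ y → 𝟙 (x ≈? y) * f y) ≡ f x
      ∑-pick {x} {.x ∷ xs} f (x∉ ∷ _) (here refl) = begin
        𝟙 (x ≈? x) * f x + ∑ xs (λ y → 𝟙 (x ≈? y) * f y)
          ≡⟨ cong₂ (λ i j → i * f x + j) (𝟙-yes (x ≈? x) refl)
               (∑-pick-∉ f λ x∈xs → All.lookup x∉ x∈xs refl) ⟩
        1ℤ * f x + 0ℤ  ≡⟨ +-identityʳ _ ⟩
        1ℤ * f x       ≡⟨ *-identityˡ _ ⟩
        f x            ∎
      ∑-pick {x} {y ∷ xs} f (y∉ ∷ xs!) (there x∈xs) = begin
        𝟙 (x ≈? y) * f y + ∑ xs (λ y → 𝟙 (x ≈? y) * f y)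
          ≡⟨ cong₂ (λ i j → i * f y + j) (𝟙-no (x ≈? y) λ { refl → All.lookup y∉ x∈xs refl })
               (∑-pick f xs! x∈xs) ⟩
        0ℤ + f x  ≡⟨ +-identityˡ _ ⟩
        f x       ∎

  module _ {a b} {X : Set a} {Y : Set b} where

    ∑-map : ∀ (h : X → Y) xs (f : Y → ℤ) → ∑ (map h xs) f ≡ ∑ xs (f ∘ h)
    ∑-map h []       f = refl
    ∑-map h (x ∷ xs) f = cong (_+_ (f (h x))) (∑-map h xs f)

    ∑-swap : ∀ xs ys (f : X → Y → ℤ) →
             ∑ xs (λ x → ∑ ys (f x)) ≡ ∑ ys (λ y → ∑ xs (λ x → f x y))
    ∑-swap []       ys f = sym (∑-zero ys)
    ∑-swap (x ∷ xs) ys f = trans (cong (_+_ (∑ ys (f x))) (∑-swap xs ys f)) (sym (∑-+ ys (f x) _))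

    ∑-*-∑ : ∀ xs ys (f : X → ℤ) (g : Y → ℤ) →
            ∑ xs f * ∑ ys g ≡ ∑ xs (λ x → ∑ ys (λ y → f x * g y))
    ∑-*-∑ xs ys f g = trans (sym (∑-*ʳ xs (∑ ys g) f)) (∑-cong xs λ x → sym (∑-*ˡ ys (f x) g))

  ∑-cartesianProductWith : ∀ {a b c} {X : Set a} {Y : Set b} {Z : Set c} (h : X → Y → Z) xs ys (f : Z → ℤ) →
    ∑ (cartesianProductWith h xs ys) f ≡ ∑ xs (λ x → ∑ ys (λ y → f (h x y)))
  ∑-cartesianProductWith h []       ys f = refl
  ∑-cartesianProductWith h (x ∷ xs) ys f = trans (∑-++ (map (h x) ys) _ f)
    (cong₂ _+_ (∑-map (h x) ys f) (∑-cartesianProductWith h xs ys f))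

  -- Counting equivalence classes

  module _ {a r} {X : Set a} {R : X → X → Set r} (R? : Decidable R)
           (R-sym : Symmetric R) (R-trans : Transitive R) where

    -- Every element has exactly one representative. If the head `x` is related to `y`, all that
    -- survives the filter is unrelated to `x` and hence, by symmetry and transitivity, to `y`.
    -- Otherwise the filter removes nothing related to `y`, and the induction hypothesis gives the
    -- one representative.
    ∑-deduplicate : ∀ {y xs} → y ∈ xs → R y y → ∑ (deduplicate R? xs) (λ x → 𝟙 (R? x y)) ≡ 1ℤ
    ∑-deduplicate {y} {x ∷ xs} y∈ Ryy = begin
      𝟙 (R? x y) + ∑ (filter (¬? ∘ R? x) (deduplicate R? xs)) (λ z → 𝟙 (R? z y))
        ≡⟨ cong (_+_ (𝟙 (R? x y))) (∑-filter (¬? ∘ R? x) (deduplicate R? xs) _) ⟩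
      𝟙 (R? x y) + ∑ (deduplicate R? xs) (λ z → 𝟙 (¬? (R? x z)) * 𝟙 (R? z y))
        ≡⟨ rest (R? x y) y∈ ⟩
      1ℤ ∎
      where
      term-related : R x y → ∀ z → 𝟙 (¬? (R? x z)) * 𝟙 (R? z y) ≡ 0ℤ
      term-related Rxy z with R? x z
      ... | yes _   = refl
      ... | no ¬Rxz = trans (*-identityˡ _) (𝟙-no (R? z y) λ Rzy → ¬Rxz (R-trans Rxy (R-sym Rzy)))

      term-unrelated : ¬ R x y → ∀ z → 𝟙 (¬? (R? x z)) * 𝟙 (R? z y) ≡ 𝟙 (R? z y)
      term-unrelated ¬Rxy z with R? x z
      ... | yes Rxz = sym (𝟙-no (R? z y) λ Rzy → ¬Rxy (R-trans Rxz Rzy))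
      ... | no _    = *-identityˡ _

      rest : (d : Dec (R x y)) → y ∈ x ∷ xs →
             𝟙 d + ∑ (deduplicate R? xs) (λ z → 𝟙 (¬? (R? x z)) * 𝟙 (R? z y)) ≡ 1ℤ
      rest (yes Rxy) _ = cong (_+_ 1ℤ) (trans (∑-cong (deduplicate R? xs) (term-related Rxy)) (∑-zero (deduplicate R? xs)))
      rest (no ¬Rxy) (here refl)  = contradiction Ryy ¬Rxy
      rest (no ¬Rxy) (there y∈xs) = trans (+-identityˡ _)
        (trans (∑-cong (deduplicate R? xs) (term-unrelated ¬Rxy)) (∑-deduplicate y∈xs Ryy))

    deduplicate-⊆ : ∀ {x} xs → x ∈ deduplicate R? xs → x ∈ xs
    deduplicate-⊆ (y ∷ xs) (here refl) = here refl
    deduplicate-⊆ (y ∷ xs) (there x∈)  =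
      there (deduplicate-⊆ xs (proj₁ (∈-filter⁻ (¬? ∘ R? y) {xs = deduplicate R? xs} x∈)))

    -- Double counting of the related pairs of a representative and an element: each representative
    -- lies in `k` pairs, each element in one.
    length-deduplicate : ∀ k xs → (∀ {x} → x ∈ xs → R x x) →
      (∀ {x} → x ∈ xs → ∑ xs (λ y → 𝟙 (R? x y)) ≡ k) →
      + length (deduplicate R? xs) * k ≡ + length xs
    length-deduplicate k xs R-refl class-size = begin
      + length (deduplicate R? xs) * k                           ≡⟨ cong (_* k) (∑-const-1 (deduplicate R? xs)) ⟨
      ∑ (deduplicate R? xs) (λ _ → 1ℤ) * k                       ≡⟨ ∑-*ʳ (deduplicate R? xs) k (λ _ → 1ℤ) ⟨
      ∑ (deduplicate R? xs) (λ _ → 1ℤ * k)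
        ≡⟨ ∑-cong-∈ (deduplicate R? xs) (λ x∈ → trans (*-identityˡ k) (sym (class-size (deduplicate-⊆ xs x∈)))) ⟩
      ∑ (deduplicate R? xs) (λ x → ∑ xs (λ y → 𝟙 (R? x y)))      ≡⟨ ∑-swap (deduplicate R? xs) xs _ ⟩
      ∑ xs (λ y → ∑ (deduplicate R? xs) (λ x → 𝟙 (R? x y)))      ≡⟨ ∑-cong-∈ xs (λ y∈ → ∑-deduplicate y∈ (R-refl y∈)) ⟩
      ∑ xs (λ _ → 1ℤ)                                            ≡⟨ ∑-const-1 xs ⟩
      + length xs                                                ∎

  module _ {a} {X : Set a} (_≈?_ : DecidableEquality X) where
    open DecMembership _≈?_ using (_∈?_)

    -- In a list without repetitions at most one entry equals `y`, so the sum of the equality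
    -- indicators never exceeds one.
    𝟙-∈? : ∀ {y zs} → Uniqueᴸ zs → 𝟙 (y ∈? zs) ≡ ∑ zs (λ z → 𝟙 (z ≈? y))
    𝟙-∈? {y} {[]}     []         = 𝟙-no (y ∈? []) λ ()
    𝟙-∈? {y} {z ∷ zs} (z∉ ∷ zs!) = trans (split (z ≈? y)) (cong (_+_ (𝟙 (z ≈? y))) (𝟙-∈? zs!))
      where
      split : (d : Dec (z ≡ y)) → 𝟙 (y ∈? (z ∷ zs)) ≡ 𝟙 d + 𝟙 (y ∈? zs)
      split (yes refl) = trans (𝟙-yes (y ∈? (z ∷ zs)) (here refl))
        (cong (_+_ 1ℤ) (sym (𝟙-no (y ∈? zs) λ y∈zs → All.lookup z∉ y∈zs refl)))
      split (no z≢y) = trans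
        (𝟙-⇔ (y ∈? (z ∷ zs)) (y ∈? zs) (λ { (here y≡z) → contradiction (sym y≡z) z≢y ; (there y∈zs) → y∈zs }) there)
        (sym (+-identityˡ _))

    ∑-𝟙-∈? : ∀ {xs zs} → Uniqueᴸ xs → Uniqueᴸ zs → (∀ {z} → z ∈ zs → z ∈ xs) →
             ∑ xs (λ y → 𝟙 (y ∈? zs)) ≡ + length zs
    ∑-𝟙-∈? {xs} {zs} xs! zs! zs⊆xs = begin
      ∑ xs (λ y → 𝟙 (y ∈? zs))                    ≡⟨ ∑-cong xs (λ y → 𝟙-∈? zs!) ⟩
      ∑ xs (λ y → ∑ zs (λ z → 𝟙 (z ≈? y)))        ≡⟨ ∑-swap xs zs _ ⟩
      ∑ zs (λ z → ∑ xs (λ y → 𝟙 (z ≈? y)))        ≡⟨ ∑-cong zs (λ z → ∑-cong xs λ y → *-identityʳ _) ⟨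
      ∑ zs (λ z → ∑ xs (λ y → 𝟙 (z ≈? y) * 1ℤ))   ≡⟨ ∑-cong-∈ zs (λ z∈zs → ∑-pick _≈?_ _ xs! (zs⊆xs z∈zs)) ⟩
      ∑ zs (λ _ → 1ℤ)                             ≡⟨ ∑-const-1 zs ⟩
      + length zs                                 ∎

  -- Sequences up to rotation

  module _ {a} {X : Set a} where

    sequences! : ∀ {xs : List X} → Uniqueᴸ xs → ∀ k → Uniqueᴸ (sequences xs k)
    sequences! xs! zero    = [] ∷ []
    sequences! xs! (suc k) = Uniqueᴸ.cartesianProductWith⁺ _∷_ ∷-injective xs! (sequences! xs! k)

    ∈-sequences : ∀ {xs : List X} → (∀ x → x ∈ xs) → ∀ {k} (v : Vec X k) → v ∈ sequences xs k
    ∈-sequences ∈xs []      = here refl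
    ∈-sequences ∈xs (x ∷ v) = ∈-cartesianProductWith⁺ _∷_ (∈xs x) (∈-sequences ∈xs v)

  -- The five rotations begin with the five different vertices, so their heads already tell them
  -- apart.
  rotations! : ∀ {n} (v : Vec (Fin n) 5) → Unique v → Uniqueᴸ (List.iterate rotate v 5)
  rotations! (a ∷ b ∷ c ∷ d ∷ e ∷ [])
    ((ab Allⱽ.∷ ac Allⱽ.∷ ad Allⱽ.∷ ae Allⱽ.∷ Allⱽ.[]) ∷ (bc Allⱽ.∷ bd Allⱽ.∷ be Allⱽ.∷ Allⱽ.[]) ∷
     (cd Allⱽ.∷ ce Allⱽ.∷ Allⱽ.[]) ∷ (de Allⱽ.∷ Allⱽ.[]) ∷ Allⱽ.[] ∷ []) =
    AllPairs.map (λ ≢head v≡w → ≢head (cong head v≡w))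
      (AllPairs.map⁻ {f = head}
        ((ab ∷ ac ∷ ad ∷ ae ∷ []) ∷ (bc ∷ bd ∷ be ∷ []) ∷ (cd ∷ ce ∷ []) ∷ (de ∷ []) ∷ [] ∷ []))

  -- Membership in a list of five iterates is neither visibly symmetric nor visibly transitive.
  -- Allowing any number of turns makes transitivity a concatenation, and `Rotation⇒iterate` returns
  -- to the list.
  data Rotation {a} {X : Set a} {k} : Vec X k → Vec X k → Set a where
    stop : ∀ {v} → Rotation v v
    turn : ∀ {v w} → Rotation (rotate v) w → Rotation v w

  module _ {a} {X : Set a} where

    Rotation-trans : ∀ {k} → Transitive (Rotation {X = X} {k})
    Rotation-trans stop     s = s
    Rotation-trans (turn r) s = turn (Rotation-trans r s)

    iterate⇒Rotation : ∀ {k} j {v w : Vec X k} → w ∈ List.iterate rotate v j → Rotation v w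
    iterate⇒Rotation (suc j) (here refl) = stop
    iterate⇒Rotation (suc j) (there w∈)  = turn (iterate⇒Rotation j w∈)

    Rotation⇒iterate : ∀ {v w : Vec X 5} → Rotation v w → w ∈ List.iterate rotate v 5
    Rotation⇒iterate stop = here refl
    Rotation⇒iterate {v = a ∷ b ∷ c ∷ d ∷ e ∷ []} (turn r) with Rotation⇒iterate r
    ... | here p                                 = there (here p)
    ... | there (here p)                         = there (there (here p))
    ... | there (there (here p))                 = there (there (there (here p)))
    ... | there (there (there (here p)))         = there (there (there (there (here p))))
    -- Five turns restore the sequence, so the last iterate of `rotate v` is `v` itself.
    ... | there (there (there (there (here p)))) = here p

    -- Four more turns undo a turn, since five turns are the identity.
    turn-back : ∀ (v : Vec X 5) → Rotation (rotate v) v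
    turn-back (a ∷ b ∷ c ∷ d ∷ e ∷ []) = turn (turn (turn (turn stop)))

    Rotation-sym : ∀ {v w : Vec X 5} → Rotation v w → Rotation w v
    Rotation-sym stop     = stop
    Rotation-sym {v} (turn r) = Rotation-trans (Rotation-sym r) (turn-back v)

  SameCycle-sym : ∀ {n} → Symmetric (SameCycle {n} {5})
  SameCycle-sym = Rotation⇒iterate ∘ Rotation-sym ∘ iterate⇒Rotation 5

  SameCycle-trans : ∀ {n} → Transitive (SameCycle {n} {5})
  SameCycle-trans r s = Rotation⇒iterate (Rotation-trans (iterate⇒Rotation 5 r) (iterate⇒Rotation 5 s))

  module _ {n : ℕ} (T : Tournament n) where
    open Tournament T

    rotate-cycle : ∀ {v : Vec (Fin n) 5} → IsCycle T v → IsCycle T (rotate v)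
    rotate-cycle {a ∷ b ∷ c ∷ d ∷ e ∷ []}
      ((ab Allⱽ.∷ ac Allⱽ.∷ ad Allⱽ.∷ ae Allⱽ.∷ Allⱽ.[]) ∷ (bc Allⱽ.∷ bd Allⱽ.∷ be Allⱽ.∷ Allⱽ.[]) ∷
       (cd Allⱽ.∷ ce Allⱽ.∷ Allⱽ.[]) ∷ (de Allⱽ.∷ Allⱽ.[]) ∷ Allⱽ.[] ∷ []
      , Eab ∷ Ebc ∷ Ecd ∷ Ede ∷ Eea ∷ []) =
      (bc Allⱽ.∷ bd Allⱽ.∷ be Allⱽ.∷ ab ∘ sym Allⱽ.∷ Allⱽ.[]) ∷ (cd Allⱽ.∷ ce Allⱽ.∷ ac ∘ sym Allⱽ.∷ Allⱽ.[]) ∷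
       (de Allⱽ.∷ ad ∘ sym Allⱽ.∷ Allⱽ.[]) ∷ (ae ∘ sym Allⱽ.∷ Allⱽ.[]) ∷ Allⱽ.[] ∷ []
      , Ebc ∷ Ecd ∷ Ede ∷ Eea ∷ Eab ∷ []

    cycles : List (Vec (Fin n) 5)
    cycles = filter (isCycle? T) (sequences (allFin n) 5)

    -- The class of a cycle consists of its five rotations, which are pairwise different and are
    -- again cycles.
    c-5 : + c T 5 * + 5 ≡ + length cycles
    c-5 = length-deduplicate sameCycle? SameCycle-sym SameCycle-trans (+ 5) cycles (λ _ → here refl)
      λ {v} v∈ → ∑-𝟙-∈? (≡-dec _≟_)
        (Uniqueᴸ.filter⁺ (isCycle? T) (sequences! (Uniqueᴸ.allFin⁺ n) 5))
        (rotations! v (proj₁ (cycle∈ v∈)))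
        (rotation∈ 5 (cycle∈ v∈))
      where
      cycle∈ : ∀ {v} → v ∈ cycles → IsCycle T v
      cycle∈ v∈ = proj₂ (∈-filter⁻ (isCycle? T) {xs = sequences (allFin n) 5} v∈)

      rotation∈ : ∀ j {v w} → IsCycle T v → w ∈ List.iterate rotate v j → w ∈ cycles
      rotation∈ (suc j) {v} v↻ (here refl) = ∈-filter⁺ (isCycle? T) (∈-sequences ∈-allFin v) v↻
      rotation∈ (suc j) v↻ (there w∈)  = rotation∈ j (rotate-cycle v↻) w∈

  -- Sums over sequences of distinct vertices

  -- Stated with an integer difference, the absorption identity holds for all `n` and `k`: both
  -- binomials vanish when `k` exceeds `n`. The induction on `n` uses Pascal's rule twice, the
  -- second time in `rest`, for the companion identity that raises `n` instead of `k`.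
  [1+k]*nC[1+k]≡[n-k]*nCk : ∀ n k → + suc k * + (n choose suc k) ≡ (+ n - + k) * + (n choose k)
  [1+k]*nC[1+k]≡[n-k]*nCk zero    zero    = refl
  [1+k]*nC[1+k]≡[n-k]*nCk zero    (suc k) = trans (*-zeroʳ (+ suc (suc k))) (sym (*-zeroʳ (0ℤ - + suc k)))
  [1+k]*nC[1+k]≡[n-k]*nCk (suc n) k       = begin
    + suc k * + (suc n choose suc k)
      ≡⟨ cong (_*_ (+ suc k)) (pascal n k) ⟩
    + suc k * (+ (n choose k) + + (n choose suc k))
      ≡⟨ *-distribˡ-+ (+ suc k) (+ (n choose k)) (+ (n choose suc k)) ⟩
    + suc k * + (n choose k) + + suc k * + (n choose suc k)
      ≡⟨ cong₂ _+_ (cong (_* + (n choose k)) (pos-+ 1 k)) ([1+k]*nC[1+k]≡[n-k]*nCk n k) ⟩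
    (1ℤ + + k) * + (n choose k) + (+ n - + k) * + (n choose k)
      ≡⟨ collect (+ n) (+ k) (+ (n choose k)) ⟩
    (1ℤ + + n) * + (n choose k)
      ≡⟨ rest k ⟩
    (+ suc n - + k) * + (suc n choose k) ∎
    where
    pascal : ∀ n k → + (suc n choose suc k) ≡ + (n choose k) + + (n choose suc k)
    pascal n k = trans (cong +_ (sym (nCk+nC[k+1]≡[n+1]C[k+1] n k))) (pos-+ (n choose k) _)

    collect : ∀ n k b → (1ℤ + k) * b + (n - k) * b ≡ (1ℤ + n) * b
    collect = solve-∀

    spread : ∀ n j b → (1ℤ + n) * b ≡ (1ℤ + j) * b + (n - j) * b
    spread = solve-∀

    shift : ∀ n j b b′ → (n - j) * b + (n - j) * b′ ≡ ((1ℤ + n) - (1ℤ + j)) * (b + b′)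
    shift = solve-∀

    rest : ∀ k → (1ℤ + + n) * + (n choose k) ≡ (+ suc n - + k) * + (suc n choose k)
    rest zero    = cong (_* 1ℤ) (sym (+-identityʳ (+ suc n)))
    rest (suc j) = begin
      (1ℤ + + n) * + (n choose suc j)
        ≡⟨ spread (+ n) (+ j) (+ (n choose suc j)) ⟩
      + suc j * + (n choose suc j) + (+ n - + j) * + (n choose suc j)
        ≡⟨ cong (_+ (+ n - + j) * + (n choose suc j)) ([1+k]*nC[1+k]≡[n-k]*nCk n j) ⟩
      (+ n - + j) * + (n choose j) + (+ n - + j) * + (n choose suc j)
        ≡⟨ shift (+ n) (+ j) (+ (n choose j)) (+ (n choose suc j)) ⟩
      (+ suc n - + suc j) * (+ (n choose j) + + (n choose suc j))
        ≡⟨ cong (_*_ (+ suc n - + suc j)) (pascal n j) ⟨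
      (+ suc n - + suc j) * + (suc n choose suc j) ∎

  -- Permutations of the coordinates

  infixl 5 _⨾_

  -- Permutations are words in adjacent transpositions, so invariance of a nested sum reduces to
  -- exchanging two neighbouring sums.
  data Perm : ℕ → Set where
    swap : ∀ {k} → Perm (suc (suc k))
    skip : ∀ {k} → Perm k → Perm (suc k)
    _⨾_  : ∀ {k} → Perm k → Perm k → Perm k

  act : ∀ {a} {X : Set a} {k} → Perm k → Vec X k → Vec X k
  act swap     (x ∷ y ∷ v) = y ∷ x ∷ v
  act (skip π) (x ∷ v)     = x ∷ act π v
  act (π ⨾ σ)  v           = act σ (act π v)

  module _ {n : ℕ} where

    ∑ᶠ : (Fin n → ℤ) → ℤ
    ∑ᶠ = ∑ (allFin n)

    ∑ⁿ : ∀ k → (Vec (Fin n) k → ℤ) → ℤ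
    ∑ⁿ zero    f = f []
    ∑ⁿ (suc k) f = ∑ᶠ λ x → ∑ⁿ k (f ∘ (x ∷_))

    ∑ⁿ-cong : ∀ k {f g : Vec (Fin n) k → ℤ} → (∀ v → f v ≡ g v) → ∑ⁿ k f ≡ ∑ⁿ k g
    ∑ⁿ-cong zero    f≗g = f≗g []
    ∑ⁿ-cong (suc k) f≗g = ∑-cong (allFin n) λ x → ∑ⁿ-cong k λ v → f≗g (x ∷ v)

    ∑ⁿ-+ : ∀ k (f g : Vec (Fin n) k → ℤ) → ∑ⁿ k (λ v → f v + g v) ≡ ∑ⁿ k f + ∑ⁿ k g
    ∑ⁿ-+ zero    f g = refl
    ∑ⁿ-+ (suc k) f g = trans (∑-cong (allFin n) λ x → ∑ⁿ-+ k (f ∘ (x ∷_)) (g ∘ (x ∷_))) (∑-+ (allFin n) _ _)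

    ∑ⁿ-*ˡ : ∀ k i (f : Vec (Fin n) k → ℤ) → ∑ⁿ k (λ v → i * f v) ≡ i * ∑ⁿ k f
    ∑ⁿ-*ˡ zero    i f = refl
    ∑ⁿ-*ˡ (suc k) i f = trans (∑-cong (allFin n) λ x → ∑ⁿ-*ˡ k i (f ∘ (x ∷_))) (∑-*ˡ (allFin n) i _)

    ∑ⁿ-swap : ∀ k (f : Fin n → Vec (Fin n) k → ℤ) →
              ∑ᶠ (λ x → ∑ⁿ k (f x)) ≡ ∑ⁿ k (λ v → ∑ᶠ (λ x → f x v))
    ∑ⁿ-swap zero    f = refl
    ∑ⁿ-swap (suc k) f = trans (∑-swap (allFin n) (allFin n) _)
      (∑-cong (allFin n) λ y → ∑ⁿ-swap k (λ x → f x ∘ (y ∷_)))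

    ∑-sequences : ∀ k (f : Vec (Fin n) k → ℤ) → ∑ (sequences (allFin n) k) f ≡ ∑ⁿ k f
    ∑-sequences zero    f = +-identityʳ _
    ∑-sequences (suc k) f = trans (∑-cartesianProductWith _∷_ (allFin n) (sequences (allFin n) k) f)
      (∑-cong (allFin n) λ x → ∑-sequences k (f ∘ (x ∷_)))

    ∑ⁿ-act : ∀ {k} (π : Perm k) (f : Vec (Fin n) k → ℤ) → ∑ⁿ k (f ∘ act π) ≡ ∑ⁿ k f
    ∑ⁿ-act swap     f = ∑-swap (allFin n) (allFin n) _
    ∑ⁿ-act (skip π) f = ∑-cong (allFin n) λ x → ∑ⁿ-act π (f ∘ (x ∷_))
    ∑ⁿ-act (π ⨾ σ)  f = trans (∑ⁿ-act π (f ∘ act σ)) (∑ⁿ-act σ f)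

    δ : Fin n → Fin n → ℤ
    δ x y = 𝟙 (¬? (x ≟ y))

    δ-sym : ∀ x y → δ x y ≡ δ y x
    δ-sym x y = 𝟙-⇔ (¬? (x ≟ y)) (¬? (y ≟ x)) (_∘ sym) (_∘ sym)

    δ-refl : ∀ x → δ x x ≡ 0ℤ
    δ-refl x = 𝟙-no (¬? (x ≟ x)) (λ x≢x → x≢x refl)

    δ-≢ : ∀ {x y} → x ≢ y → δ x y ≡ 1ℤ
    δ-≢ {x} {y} = 𝟙-yes (¬? (x ≟ y))

    ∑-split-δ : ∀ x (f : Fin n → ℤ) → ∑ᶠ f ≡ ∑ᶠ (λ y → δ x y * f y) + f x
    ∑-split-δ x f = begin
      ∑ᶠ f
        ≡⟨ ∑-cong (allFin n) (λ y → trans (split (𝟙 (x ≟ y)) (f y))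
             (cong (λ i → i * f y + 𝟙 (x ≟ y) * f y) (sym (𝟙-¬ (x ≟ y))))) ⟩
      ∑ᶠ (λ y → δ x y * f y + 𝟙 (x ≟ y) * f y)
        ≡⟨ ∑-+ (allFin n) _ _ ⟩
      ∑ᶠ (λ y → δ x y * f y) + ∑ᶠ (λ y → 𝟙 (x ≟ y) * f y)
        ≡⟨ cong (_+_ (∑ᶠ (λ y → δ x y * f y))) (∑-pick _≟_ f (Uniqueᴸ.allFin⁺ n) (∈-allFin x)) ⟩
      ∑ᶠ (λ y → δ x y * f y) + f x ∎
      where
      split : ∀ i j → j ≡ (1ℤ - i) * j + i * j
      split = solve-∀

    fresh : ∀ {k} → Fin n → Vec (Fin n) k → ℤ
    fresh x []      = 1ℤ
    fresh x (y ∷ v) = δ x y * fresh x v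

    -- The indicator of `Unique` is kept as a product of factors `δ`, so that permuting coordinates
    -- or splitting off a vertex becomes ring arithmetic.
    distinct : ∀ {k} → Vec (Fin n) k → ℤ
    distinct []      = 1ℤ
    distinct (x ∷ v) = fresh x v * distinct v

    unique? : ∀ {k} → U.Decidable (Unique {A = Fin n} {k})
    unique? = AllPairsⱽ.allPairs? (λ x y → ¬? (x ≟ y))

    𝟙-fresh : ∀ {k} x (v : Vec (Fin n) k) → 𝟙 (Allⱽ.all? (λ y → ¬? (x ≟ y)) v) ≡ fresh x v
    𝟙-fresh x []      = refl
    𝟙-fresh x (y ∷ v) = trans (𝟙-× (¬? (x ≟ y)) (Allⱽ.all? (λ y → ¬? (x ≟ y)) v))
      (cong (_*_ (δ x y)) (𝟙-fresh x v))

    𝟙-unique : ∀ {k} (v : Vec (Fin n) k) → 𝟙 (unique? v) ≡ distinct v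
    𝟙-unique []      = refl
    𝟙-unique (x ∷ v) = trans (𝟙-× (Allⱽ.all? (λ y → ¬? (x ≟ y)) v) (unique? v))
      (cong₂ _*_ (𝟙-fresh x v) (𝟙-unique v))

    -- The weight vanishes on a sequence with a repeated vertex, so an equation under it has to be
    -- shown for distinct vertices only.
    distinct-*-cong : ∀ {k} (v : Vec (Fin n) k) {i j} → (Unique v → i ≡ j) → distinct v * i ≡ distinct v * j
    distinct-*-cong v {i} {j} eq = subst (λ u → u * i ≡ u * j) (𝟙-unique v) (by (unique? v))
      where
      by : (d : Dec (Unique v)) → 𝟙 d * i ≡ 𝟙 d * j
      by (yes v!) = cong (_*_ 1ℤ) (eq v!)
      by (no _)   = refl

    fresh-act : ∀ {k} (π : Perm k) x v → fresh x (act π v) ≡ fresh x v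
    fresh-act swap     x (y ∷ z ∷ v) = *-exchange (δ x z) (δ x y) (fresh x v)
    fresh-act (skip π) x (y ∷ v)     = cong (_*_ (δ x y)) (fresh-act π x v)
    fresh-act (π ⨾ σ)  x v           = trans (fresh-act σ x (act π v)) (fresh-act π x v)

    distinct-act : ∀ {k} (π : Perm k) v → distinct (act π v) ≡ distinct v
    distinct-act swap (x ∷ y ∷ v) = trans
      (cong (λ i → i * fresh y v * (fresh x v * distinct v)) (δ-sym y x))
      (interchange *-commutativeSemigroup (δ x y) (fresh y v) (fresh x v) (distinct v))
    distinct-act (skip π) (x ∷ v) = cong₂ _*_ (fresh-act π x v) (distinct-act π v)
    distinct-act (π ⨾ σ)  v       = trans (distinct-act σ (act π v)) (distinct-act π v)

    -- A sequence of `k` distinct vertices leaves `n - k` others. The weight on both sides carries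
    -- the distinctness through the induction: a new vertex `y` lowers the count by `fresh y v`,
    -- which is one under the weight.
    distinct-*-∑-fresh : ∀ {k} (v : Vec (Fin n) k) →
      distinct v * ∑ᶠ (λ x → fresh x v) ≡ distinct v * (+ n - + k)
    distinct-*-∑-fresh [] = cong (_*_ 1ℤ) (begin
      ∑ᶠ (λ _ → 1ℤ)          ≡⟨ ∑-const-1 (allFin n) ⟩
      + length (allFin n)    ≡⟨ cong +_ (length-tabulate {n = n} id) ⟩
      + n                    ≡⟨ +-identityʳ (+ n) ⟨
      + n - 0ℤ               ∎)
    distinct-*-∑-fresh {suc k} (y ∷ v) = begin
      fresh y v * distinct v * ∑ᶠ (λ x → δ x y * fresh x v)
        ≡⟨ cong (_*_ (fresh y v * distinct v)) (∑-cong (allFin n) λ x → cong (_* fresh x v) (δ-sym x y)) ⟩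
      fresh y v * distinct v * ∑ᶠ (λ x → δ y x * fresh x v)
        -- The term at `x = y`, of value `fresh y v`, is added and subtracted, which completes the
        -- sum to the one in the induction hypothesis.
        ≡⟨ complete (fresh y v) (distinct v) _ ⟩
      fresh y v * (distinct v * (∑ᶠ (λ x → δ y x * fresh x v) + fresh y v)) - distinct (y ∷ v) * fresh y v
        ≡⟨ cong (λ i → fresh y v * (distinct v * i) - distinct (y ∷ v) * fresh y v) (∑-split-δ y (λ x → fresh x v)) ⟨
      fresh y v * (distinct v * ∑ᶠ (λ x → fresh x v)) - distinct (y ∷ v) * fresh y v
        ≡⟨ cong₂ (λ i j → fresh y v * i - j) (distinct-*-∑-fresh v)
             (distinct-*-cong (y ∷ v) λ { (y∉v ∷ _) →
               trans (sym (𝟙-fresh y v)) (𝟙-yes (Allⱽ.all? (λ x → ¬? (y ≟ x)) v) y∉v) }) ⟩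
      fresh y v * (distinct v * (+ n - + k)) - distinct (y ∷ v) * 1ℤ
        ≡⟨ collect (fresh y v) (distinct v) (+ n) (+ k) ⟩
      fresh y v * distinct v * (+ n - + suc k) ∎
      where
      complete : ∀ f u s → f * u * s ≡ f * (u * (s + f)) - f * u * f
      complete = solve-∀

      collect : ∀ f u n k → f * (u * (n - k)) - f * u * 1ℤ ≡ f * u * (n - (1ℤ + k))
      collect = solve-∀

    -- Summing over the first vertex innermost gives the factor `n - k`, so the sum is a falling
    -- factorial; the absorption identity turns it into a binomial coefficient.
    ∑-distinct : ∀ k → ∑ⁿ k distinct ≡ + (k ! ℕ.* (n choose k))
    ∑-distinct zero    = refl
    ∑-distinct (suc k) = begin
      ∑ᶠ (λ x → ∑ⁿ k (λ v → fresh x v * distinct v))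
        ≡⟨ ∑ⁿ-swap k _ ⟩
      ∑ⁿ k (λ v → ∑ᶠ (λ x → fresh x v * distinct v))
        ≡⟨ ∑ⁿ-cong k (λ v → begin
             ∑ᶠ (λ x → fresh x v * distinct v)    ≡⟨ ∑-*ʳ (allFin n) (distinct v) _ ⟩
             ∑ᶠ (λ x → fresh x v) * distinct v    ≡⟨ *-comm _ (distinct v) ⟩
             distinct v * ∑ᶠ (λ x → fresh x v)    ≡⟨ distinct-*-∑-fresh v ⟩
             distinct v * (+ n - + k)             ≡⟨ *-comm (distinct v) _ ⟩
             (+ n - + k) * distinct v             ∎) ⟩
      ∑ⁿ k (λ v → (+ n - + k) * distinct v)
        ≡⟨ ∑ⁿ-*ˡ k (+ n - + k) distinct ⟩
      (+ n - + k) * ∑ⁿ k distinct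
        ≡⟨ cong (_*_ (+ n - + k)) (trans (∑-distinct k) (pos-* (k !) (n choose k))) ⟩
      (+ n - + k) * (+ (k !) * + (n choose k))
        ≡⟨ *-exchange (+ n - + k) (+ (k !)) (+ (n choose k)) ⟩
      + (k !) * ((+ n - + k) * + (n choose k))
        ≡⟨ cong (_*_ (+ (k !))) ([1+k]*nC[1+k]≡[n-k]*nCk n k) ⟨
      + (k !) * (+ suc k * + (n choose suc k))
        ≡⟨ regroup (+ (k !)) (+ suc k) (+ (n choose suc k)) ⟩
      + suc k * + (k !) * + (n choose suc k)
        ≡⟨ cong (_* + (n choose suc k)) (pos-* (suc k) (k !)) ⟨
      + (suc k !) * + (n choose suc k)
        ≡⟨ pos-* (suc k !) (n choose suc k) ⟨
      + (suc k ! ℕ.* (n choose suc k)) ∎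
      where
      regroup : ∀ i j k → i * (j * k) ≡ j * i * k
      regroup = solve-∀

    -- Opaque, so that the unifier does not unfold the nested sum.
    opaque
      ∑≢ : ∀ {k} → (Vec (Fin n) k → ℤ) → ℤ
      ∑≢ {k} f = ∑ⁿ k (λ v → distinct v * f v)

      ∑≢-def : ∀ {k} (f : Vec (Fin n) k → ℤ) → ∑≢ f ≡ ∑ⁿ k (λ v → distinct v * f v)
      ∑≢-def f = refl

      ∑≢-cong : ∀ {k} {f g : Vec (Fin n) k → ℤ} → (∀ v → Unique v → f v ≡ g v) → ∑≢ f ≡ ∑≢ g
      ∑≢-cong {k} f≗g = ∑ⁿ-cong k λ v → distinct-*-cong v (f≗g v)

      ∑≢-act : ∀ {k} (π : Perm k) (f : Vec (Fin n) k → ℤ) → ∑≢ (f ∘ act π) ≡ ∑≢ f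
      ∑≢-act {k} π f = trans
        (∑ⁿ-cong k λ v → cong (_* f (act π v)) (sym (distinct-act π v)))
        (∑ⁿ-act π (λ v → distinct v * f v))

      ∑≢-+ : ∀ {k} (f g : Vec (Fin n) k → ℤ) → ∑≢ (λ v → f v + g v) ≡ ∑≢ f + ∑≢ g
      ∑≢-+ {k} f g = trans (∑ⁿ-cong k λ v → *-distribˡ-+ (distinct v) (f v) (g v)) (∑ⁿ-+ k _ _)

      ∑≢-*ˡ : ∀ {k} i (f : Vec (Fin n) k → ℤ) → ∑≢ (λ v → i * f v) ≡ i * ∑≢ f
      ∑≢-*ˡ {k} i f = trans (∑ⁿ-cong k λ v → *-exchange (distinct v) i (f v)) (∑ⁿ-*ˡ k i _)

  -- The position of x relative to y encoded as 0, 1, 2 for E x y, x ≡ y, E y x,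
  -- so that identities between polynomials in the indicators can be decided.
  ahead behind apart : Fin 3 → ℤ
  ahead  0F = 1ℤ
  ahead  1F = 0ℤ
  ahead  2F = 0ℤ
  behind 0F = 0ℤ
  behind 1F = 0ℤ
  behind 2F = 1ℤ
  apart  0F = 1ℤ
  apart  1F = 0ℤ
  apart  2F = 1ℤ

  -- Matching on `at` fixes all three indicators at once, so inconsistent combinations never arise.
  data Compared : ℤ → ℤ → ℤ → Set where
    at : ∀ o → Compared (ahead o) (behind o) (apart o)

  -- Two compared pairs admit nine joint positions, and the implicit argument checks them by
  -- evaluation. This reaches identities that hold for values of indicators but not as ring
  -- identities.
  decide₂ : ∀ (f g : (p q i p′ q′ j : ℤ) → ℤ)
    {_ : True (all? λ o → all? λ o′ →
      f (ahead o) (behind o) (apart o) (ahead o′) (behind o′) (apart o′) ≟ᶻ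
      g (ahead o) (behind o) (apart o) (ahead o′) (behind o′) (apart o′))} →
    ∀ {p q i p′ q′ j} → Compared p q i → Compared p′ q′ j → f p q i p′ q′ j ≡ g p q i p′ q′ j
  decide₂ f g {f≗g} (at o) (at o′) = toWitness f≗g o o′

  -- Signs of arcs

  module Signs {n : ℕ} (T : Tournament n) where
    open Tournament T

    e s : Fin n → Fin n → ℤ
    e x y = 𝟙 (E? x y)
    s x y = e x y - e y x

    cmp : ∀ x y → Compared (e x y) (e y x) (δ x y)
    cmp x y = by (compare x y)
      where
      at′ : ∀ o {p q i} → p ≡ ahead o → q ≡ behind o → i ≡ apart o → Compared p q i
      at′ o refl refl refl = at o

      by : Tri (E x y) (x ≡ y) (E y x) → Compared (e x y) (e y x) (δ x y)
      by (tri< Exy x≢y ¬Eyx)   = at′ 0F (𝟙-yes (E? x y) Exy) (𝟙-no (E? y x) ¬Eyx) (δ-≢ x≢y)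
      by (tri≈ ¬Exy refl ¬Eyx) = at′ 1F (𝟙-no (E? x y) ¬Exy) (𝟙-no (E? y x) ¬Eyx) (δ-refl x)
      by (tri> ¬Exy x≢y Eyx)   = at′ 2F (𝟙-no (E? x y) ¬Exy) (𝟙-yes (E? y x) Eyx) (δ-≢ x≢y)

    e+e≡δ : ∀ x y → e x y + e y x ≡ δ x y
    e+e≡δ x y = by (cmp x y)
      where
      by : ∀ {p q i} → Compared p q i → p + q ≡ i
      by (at 0F) = refl
      by (at 1F) = refl
      by (at 2F) = refl

    2e≡1+s : ∀ {x y} → x ≢ y → + 2 * e x y ≡ 1ℤ + s x y
    2e≡1+s {x} {y} x≢y = by (cmp x y) (δ-≢ x≢y)
      where
      -- The equation `i ≡ 1ℤ` excludes position `1F`, where the identity would read zero equals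
      -- one.
      by : ∀ {p q i} → Compared p q i → i ≡ 1ℤ → + 2 * p ≡ 1ℤ + (p - q)
      by (at 0F) _ = refl
      by (at 2F) _ = refl

    s-antisym : ∀ x y → s y x ≡ - s x y
    s-antisym x y = negate (e y x) (e x y)
      where
      negate : ∀ i j → i - j ≡ - (j - i)
      negate = solve-∀

  -- Cycles as a sum over signs

  -- Rotation, and the reflection (a , b , c , d , e) ↦ (b , a , e , d , c).
  ρ reflect : Perm 5
  ρ       = swap ⨾ skip swap ⨾ skip (skip swap) ⨾ skip (skip (skip swap))
  reflect = swap ⨾ skip (skip swap) ⨾ skip (skip (skip swap)) ⨾ skip (skip swap)

  module _ {n : ℕ} where

    orbit : (Vec (Fin n) 5 → ℤ) → Vec (Fin n) 5 → ℤ
    orbit f v = f v + (f (act ρ v) + (f (act (ρ ⨾ ρ) v) + (f (act (ρ ⨾ ρ ⨾ ρ) v) + f (act (ρ ⨾ ρ ⨾ ρ ⨾ ρ) v))))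

    -- Each rotation permutes the coordinates and so leaves the sum unchanged. This replaces the
    -- fifteen even products of signs by the three in `even`.
    ∑≢-orbit : ∀ f → ∑≢ (orbit f) ≡ + 5 * ∑≢ f
    ∑≢-orbit f = begin
      ∑≢ (orbit f)                              ≡⟨ ∑≢-+ f (λ v → f₁ v + (f₂ v + (f₃ v + f₄ v))) ⟩
      ∑≢ f + ∑≢ (λ v → f₁ v + (f₂ v + (f₃ v + f₄ v)))
        ≡⟨ cong (_+_ (∑≢ f)) (∑≢-+ f₁ (λ v → f₂ v + (f₃ v + f₄ v))) ⟩
      ∑≢ f + (∑≢ f₁ + ∑≢ (λ v → f₂ v + (f₃ v + f₄ v)))
        ≡⟨ cong (λ i → ∑≢ f + (∑≢ f₁ + i)) (trans (∑≢-+ f₂ (λ v → f₃ v + f₄ v)) (cong (_+_ (∑≢ f₂)) (∑≢-+ f₃ f₄))) ⟩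
      ∑≢ f + (∑≢ f₁ + (∑≢ f₂ + (∑≢ f₃ + ∑≢ f₄)))
        ≡⟨ cong (_+_ (∑≢ f)) (cong₂ _+_ (∑≢-act ρ f) (cong₂ _+_ (∑≢-act (ρ ⨾ ρ) f)
             (cong₂ _+_ (∑≢-act (ρ ⨾ ρ ⨾ ρ) f) (∑≢-act (ρ ⨾ ρ ⨾ ρ ⨾ ρ) f)))) ⟩
      ∑≢ f + (∑≢ f + (∑≢ f + (∑≢ f + ∑≢ f)))    ≡⟨ quintuple (∑≢ f) ⟩
      + 5 * ∑≢ f                                ∎
      where
      f₁ f₂ f₃ f₄ : Vec (Fin n) 5 → ℤ
      f₁ = f ∘ act ρ
      f₂ = f ∘ act (ρ ⨾ ρ)
      f₃ = f ∘ act (ρ ⨾ ρ ⨾ ρ)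
      f₄ = f ∘ act (ρ ⨾ ρ ⨾ ρ ⨾ ρ)

      quintuple : ∀ j → j + (j + (j + (j + j))) ≡ + 5 * j
      quintuple = solve-∀

  i≡-i⇒i≡0 : ∀ i → i ≡ - i → i ≡ 0ℤ
  i≡-i⇒i≡0 (+ zero) _ = refl

  module Cycles {n : ℕ} (T : Tournament n) where
    open Tournament T
    open Signs T

    product : ∀ {k} → Vec (Fin n) k → Vec (Fin n) k → ℤ
    product []      []      = 1ℤ
    product (x ∷ v) (y ∷ w) = e x y * product v w

    𝟙-Pointwise : ∀ {k} (v w : Vec (Fin n) k) → 𝟙 (Pointwise.decidable E? v w) ≡ product v w
    𝟙-Pointwise []      []      = refl
    𝟙-Pointwise (x ∷ v) (y ∷ w) = trans (𝟙-× (E? x y) (Pointwise.decidable E? v w))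
      (cong (_*_ (e x y)) (𝟙-Pointwise v w))

    length-cycles : + length (cycles T) ≡ ∑≢ {k = 5} (λ v → product v (rotate v))
    length-cycles = begin
      + length (cycles T)                          ≡⟨ length-filter (isCycle? T) (sequences (allFin n) 5) ⟩
      ∑ (sequences (allFin n) 5) (𝟙 ∘ isCycle? T)  ≡⟨ ∑-sequences 5 (𝟙 ∘ isCycle? T) ⟩
      ∑ⁿ 5 (𝟙 ∘ isCycle? T)                        ≡⟨ ∑ⁿ-cong 5 (λ v → trans
                                                        (𝟙-× (unique? v) (Pointwise.decidable E? v (rotate v)))
                                                        (cong₂ _*_ (𝟙-unique v) (𝟙-Pointwise v (rotate v)))) ⟩
      ∑ⁿ 5 (λ v → distinct v * product v (rotate v)) ≡⟨ ∑≢-def {k = 5} (λ v → product v (rotate v)) ⟨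
      ∑≢ {k = 5} (λ v → product v (rotate v))      ∎

    signs : Vec (Fin n) 5 → ℤ
    signs (a ∷ b ∷ c ∷ d ∷ e ∷ []) =
      (1ℤ + s a b) * ((1ℤ + s b c) * ((1ℤ + s c d) * ((1ℤ + s d e) * (1ℤ + s e a))))

    -- Each of the five indicators is doubled, which gives the factor 32. Distinctness is essential:
    -- at coinciding vertices `1 + s` would be one while the indicator is zero.
    32*product≡signs : ∀ (v : Vec (Fin n) 5) → Unique v → + 32 * product v (rotate v) ≡ signs v
    32*product≡signs (a ∷ b ∷ c ∷ d ∷ f ∷ [])
      ((ab Allⱽ.∷ _ Allⱽ.∷ _ Allⱽ.∷ af Allⱽ.∷ Allⱽ.[]) ∷ (bc Allⱽ.∷ _) ∷ (cd Allⱽ.∷ _) ∷ (df Allⱽ.∷ _) ∷ _) =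
      trans (distribute (e a b) (e b c) (e c d) (e d f) (e f a))
        (cong₂ _*_ (2e≡1+s ab) (cong₂ _*_ (2e≡1+s bc) (cong₂ _*_ (2e≡1+s cd)
          (cong₂ _*_ (2e≡1+s df) (2e≡1+s (af ∘ sym))))))
      where
      distribute : ∀ i j k l m → + 32 * (i * (j * (k * (l * (m * 1ℤ))))) ≡
                   (+ 2 * i) * ((+ 2 * j) * ((+ 2 * k) * ((+ 2 * l) * (+ 2 * m))))
      distribute = solve-∀

    -- All of these read five vertices, even where the product involves fewer, so that they are
    -- summed over the same sequences.
    path₂ matching path₄ even : Vec (Fin n) 5 → ℤ
    path₂    (a ∷ b ∷ c ∷ d ∷ e ∷ []) = s a b * s b c
    matching (a ∷ b ∷ c ∷ d ∷ e ∷ []) = s a b * s c d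
    path₄    (a ∷ b ∷ c ∷ d ∷ e ∷ []) = s a b * s b c * (s c d * s d e)
    even v = path₂ v + (matching v + path₄ v)

    ∑≢-matching : ∑≢ matching ≡ 0ℤ
    ∑≢-matching = i≡-i⇒i≡0 (∑≢ matching) (begin
      ∑≢ matching                    ≡⟨ ∑≢-act swap matching ⟨
      ∑≢ (matching ∘ act swap)       ≡⟨ ∑≢-cong (λ v _ → flip v) ⟩
      ∑≢ (λ v → -1ℤ * matching v)    ≡⟨ ∑≢-*ˡ -1ℤ matching ⟩
      -1ℤ * ∑≢ matching              ≡⟨ -1*i≡-i (∑≢ matching) ⟩
      - ∑≢ matching                  ∎)
      where
      regroup : ∀ i j → - i * j ≡ -1ℤ * (i * j)
      regroup = solve-∀

      flip : ∀ v → matching (act swap v) ≡ -1ℤ * matching v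
      flip (a ∷ b ∷ c ∷ d ∷ e ∷ []) = trans (cong (_* s c d) (s-antisym a b)) (regroup (s a b) (s c d))

    ∑≢-even : ∑≢ even ≡ ∑≢ path₂ + ∑≢ path₄
    ∑≢-even = begin
      ∑≢ even                                      ≡⟨ ∑≢-+ path₂ (λ v → matching v + path₄ v) ⟩
      ∑≢ path₂ + ∑≢ (λ v → matching v + path₄ v)   ≡⟨ cong (_+_ (∑≢ path₂)) (∑≢-+ matching path₄) ⟩
      ∑≢ path₂ + (∑≢ matching + ∑≢ path₄)          ≡⟨ cong (λ i → ∑≢ path₂ + (i + ∑≢ path₄)) ∑≢-matching ⟩
      ∑≢ path₂ + (0ℤ + ∑≢ path₄)                   ≡⟨ cong (_+_ (∑≢ path₂)) (+-identityˡ _) ⟩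
      ∑≢ path₂ + ∑≢ path₄                          ∎

    -- Reflecting the cycle negates every sign, so only the products of an even
    -- number of signs survive; up to rotation these are the terms of even.
    signs+reflected : ∀ v → signs v + signs (act reflect v) ≡ + 2 * (1ℤ + orbit even v)
    signs+reflected (a ∷ b ∷ c ∷ d ∷ e ∷ []) = trans
      (cong (_+_ (signs (a ∷ b ∷ c ∷ d ∷ e ∷ [])))
        (cong₂ _*_ (1+ a b) (cong₂ _*_ (1+ e a) (cong₂ _*_ (1+ d e) (cong₂ _*_ (1+ c d) (1+ b c))))))
      (expand (s a b) (s b c) (s c d) (s d e) (s e a))
      where
      1+ : ∀ x y → 1ℤ + s y x ≡ 1ℤ + - s x y
      1+ x y = cong (_+_ 1ℤ) (s-antisym x y)

      expand : ∀ i j k l m →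
        (1ℤ + i) * ((1ℤ + j) * ((1ℤ + k) * ((1ℤ + l) * (1ℤ + m)))) +
        (1ℤ + - i) * ((1ℤ + - m) * ((1ℤ + - l) * ((1ℤ + - k) * (1ℤ + - j)))) ≡
        + 2 * (1ℤ + ((i * j + (i * k + i * j * (k * l))) + ((j * k + (j * l + j * k * (l * m))) +
                    ((k * l + (k * m + k * l * (m * i))) + ((l * m + (l * i + l * m * (i * j))) +
                     (m * i + (m * j + m * i * (j * k))))))))
      expand = solve-∀

    -- The sum is doubled to pair each sequence with its reflection, and the factor 2 is cancelled
    -- at the end. The constant term counts the sequences of five distinct vertices, where 120 is 5
    -- factorial.
    ∑≢-signs : ∑≢ signs ≡ + (120 ℕ.* (n choose 5)) + + 5 * (∑≢ path₂ + ∑≢ path₄)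
    ∑≢-signs = *-cancelˡ-≡ (+ 2) (∑≢ signs) (N + + 5 * (∑≢ path₂ + ∑≢ path₄)) (begin
      + 2 * ∑≢ signs
        ≡⟨ double (∑≢ signs) ⟩
      ∑≢ signs + ∑≢ signs
        ≡⟨ cong (_+_ (∑≢ signs)) (∑≢-act reflect signs) ⟨
      ∑≢ signs + ∑≢ (signs ∘ act reflect)
        ≡⟨ ∑≢-+ signs (signs ∘ act reflect) ⟨
      ∑≢ (λ v → signs v + signs (act reflect v))
        ≡⟨ ∑≢-cong (λ v _ → signs+reflected v) ⟩
      ∑≢ (λ v → + 2 * (1ℤ + orbit even v))
        ≡⟨ ∑≢-*ˡ (+ 2) (λ v → 1ℤ + orbit even v) ⟩
      + 2 * ∑≢ (λ v → 1ℤ + orbit even v)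
        ≡⟨ cong (_*_ (+ 2)) (∑≢-+ (λ _ → 1ℤ) (orbit even)) ⟩
      + 2 * (∑≢ {k = 5} (λ _ → 1ℤ) + ∑≢ (orbit even))
        ≡⟨ cong (_*_ (+ 2)) (cong₂ _+_ ∑≢-1 (∑≢-orbit even)) ⟩
      + 2 * (N + + 5 * ∑≢ even)
        ≡⟨ cong (λ i → + 2 * (N + + 5 * i)) ∑≢-even ⟩
      + 2 * (N + + 5 * (∑≢ path₂ + ∑≢ path₄)) ∎)
      where
      N : ℤ
      N = + (120 ℕ.* (n choose 5))

      ∑≢-1 : ∑≢ {k = 5} (λ _ → 1ℤ) ≡ N
      ∑≢-1 = trans (∑≢-def {k = 5} (λ _ → 1ℤ)) (trans (∑ⁿ-cong {n} 5 (λ v → *-identityʳ (distinct v))) (∑-distinct {n} 5))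

    -- Here 160 is 32 times 5: five halved indicators, and five rotations of each cycle.
    160*c-5 : + 160 * + c T 5 ≡ + 120 * + (n choose 5) + + 5 * (∑≢ path₂ + ∑≢ path₄)
    160*c-5 = begin
      + 160 * + c T 5                                 ≡⟨ regroup (+ c T 5) ⟩
      + 32 * (+ c T 5 * + 5)                          ≡⟨ cong (_*_ (+ 32)) (trans (c-5 T) length-cycles) ⟩
      + 32 * ∑≢ {k = 5} (λ v → product v (rotate v))  ≡⟨ ∑≢-*ˡ (+ 32) (λ v → product v (rotate v)) ⟨
      ∑≢ (λ v → + 32 * product v (rotate v))          ≡⟨ ∑≢-cong 32*product≡signs ⟩
      ∑≢ signs                                        ≡⟨ ∑≢-signs ⟩
      + (120 ℕ.* (n choose 5)) + + 5 * (∑≢ path₂ + ∑≢ path₄)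
        ≡⟨ cong (_+ + 5 * (∑≢ path₂ + ∑≢ path₄)) (pos-* 120 (n choose 5)) ⟩
      + 120 * + (n choose 5) + + 5 * (∑≢ path₂ + ∑≢ path₄) ∎
      where
      regroup : ∀ i → + 160 * i ≡ + 32 * (i * + 5)
      regroup = solve-∀

  -- Edge scores as sums over signs

  module _ {n : ℕ} where

    product₃ : (g h : Fin n → ℤ) → Vec (Fin n) 3 → ℤ
    product₃ g h (x ∷ y ∷ z ∷ []) = g x * g y * h z

    -- The hypothesis removes the diagonals on which the third index meets one of
    -- the first two, leaving the diagonal of the square as the only correction.
    ∑²*∑ : ∀ (g h : Fin n → ℤ) → (∀ w → g w * h w ≡ 0ℤ) →
           ∑ᶠ g * ∑ᶠ g * ∑ᶠ h ≡ ∑≢ (product₃ g h) + ∑ᶠ (λ w → g w * g w) * ∑ᶠ h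
    ∑²*∑ g h gh≡0 = begin
      ∑ᶠ g * ∑ᶠ g * ∑ᶠ h
        ≡⟨ cong (_* ∑ᶠ h) square ⟩
      (∑ᶠ (λ x → ∑ᶠ (λ y → δ x y * (g x * g y))) + ∑ᶠ (λ w → g w * g w)) * ∑ᶠ h
        ≡⟨ *-distribʳ-+ (∑ᶠ h) (∑ᶠ (λ x → ∑ᶠ (λ y → δ x y * (g x * g y)))) (∑ᶠ (λ w → g w * g w)) ⟩
      ∑ᶠ (λ x → ∑ᶠ (λ y → δ x y * (g x * g y))) * ∑ᶠ h + ∑ᶠ (λ w → g w * g w) * ∑ᶠ h
        ≡⟨ cong (_+ ∑ᶠ (λ w → g w * g w) * ∑ᶠ h) offdiagonal ⟩
      ∑≢ (product₃ g h) + ∑ᶠ (λ w → g w * g w) * ∑ᶠ h ∎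
      where
      square : ∑ᶠ g * ∑ᶠ g ≡ ∑ᶠ (λ x → ∑ᶠ (λ y → δ x y * (g x * g y))) + ∑ᶠ (λ w → g w * g w)
      square = begin
        ∑ᶠ g * ∑ᶠ g
          ≡⟨ ∑-*-∑ (allFin n) (allFin n) g g ⟩
        ∑ᶠ (λ x → ∑ᶠ (λ y → g x * g y))
          ≡⟨ ∑-cong (allFin n) (λ x → ∑-split-δ x (λ y → g x * g y)) ⟩
        ∑ᶠ (λ x → ∑ᶠ (λ y → δ x y * (g x * g y)) + g x * g x)
          ≡⟨ ∑-+ (allFin n) _ _ ⟩
        ∑ᶠ (λ x → ∑ᶠ (λ y → δ x y * (g x * g y))) + ∑ᶠ (λ w → g w * g w) ∎

      absorb : ∀ x z → g x * h z ≡ δ x z * (g x * h z)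
      absorb x z = by (x ≟ z)
        where
        by : Dec (x ≡ z) → g x * h z ≡ δ x z * (g x * h z)
        by (yes refl) = trans (gh≡0 x) (sym (trans (cong (_*_ (δ x x)) (gh≡0 x)) (*-zeroʳ (δ x x))))
        by (no x≢z)   = sym (trans (cong (_* (g x * h z)) (δ-≢ x≢z)) (*-identityˡ (g x * h z)))

      insert-δ : ∀ x y z → δ x y * (g x * g y) * h z ≡ distinct (x ∷ y ∷ z ∷ []) * product₃ g h (x ∷ y ∷ z ∷ [])
      insert-δ x y z = begin
        δ x y * (g x * g y) * h z                        ≡⟨ regroup₁ (δ x y) (g x) (g y) (h z) ⟩
        δ x y * g y * (g x * h z)                        ≡⟨ cong (_*_ (δ x y * g y)) (absorb x z) ⟩
        δ x y * g y * (δ x z * (g x * h z))              ≡⟨ regroup₂ (δ x y) (g y) (δ x z) (g x) (h z) ⟩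
        δ x y * δ x z * g x * (g y * h z)                ≡⟨ cong (_*_ (δ x y * δ x z * g x)) (absorb y z) ⟩
        δ x y * δ x z * g x * (δ y z * (g y * h z))      ≡⟨ regroup₃ (δ x y) (δ x z) (δ y z) (g x) (g y) (h z) ⟩
        distinct (x ∷ y ∷ z ∷ []) * (g x * g y * h z)    ∎
        where
        regroup₁ : ∀ i a b c → i * (a * b) * c ≡ i * b * (a * c)
        regroup₁ = solve-∀

        regroup₂ : ∀ i b j a c → i * b * (j * (a * c)) ≡ i * j * a * (b * c)
        regroup₂ = solve-∀

        -- The factors `1ℤ` are the values of `fresh` and `distinct` at the empty vector, as left by
        -- unfolding `distinct (x ∷ y ∷ z ∷ [])`.
        regroup₃ : ∀ i j k a b c → i * j * a * (k * (b * c)) ≡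
                   i * (j * 1ℤ) * (k * 1ℤ * (1ℤ * 1ℤ)) * (a * b * c)
        regroup₃ = solve-∀

      offdiagonal : ∑ᶠ (λ x → ∑ᶠ (λ y → δ x y * (g x * g y))) * ∑ᶠ h ≡ ∑≢ (product₃ g h)
      offdiagonal = begin
        ∑ᶠ (λ x → ∑ᶠ (λ y → δ x y * (g x * g y))) * ∑ᶠ h
          ≡⟨ ∑-*ʳ (allFin n) (∑ᶠ h) _ ⟨
        ∑ᶠ (λ x → ∑ᶠ (λ y → δ x y * (g x * g y)) * ∑ᶠ h)
          ≡⟨ ∑-cong (allFin n) (λ x → ∑-*-∑ (allFin n) (allFin n) (λ y → δ x y * (g x * g y)) h) ⟩
        ∑ᶠ (λ x → ∑ᶠ (λ y → ∑ᶠ (λ z → δ x y * (g x * g y) * h z)))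
          ≡⟨ ∑-cong (allFin n) (λ x → ∑-cong (allFin n) λ y → ∑-cong (allFin n) (insert-δ x y)) ⟩
        ∑ⁿ 3 (λ v → distinct v * product₃ g h v)
          ≡⟨ ∑≢-def (product₃ g h) ⟨
        ∑≢ (product₃ g h) ∎

  module Scores {n : ℕ} (T : Tournament n) where
    open Tournament T
    open Signs T
    open Cycles T using (path₂; path₄)

    module Edge (u v : Fin n) where

      A B C D : ℤ
      A = + scoreA T u v
      B = + scoreB T u v
      C = + scoreC T u v
      D = + scoreD T u v

      outside : Fin n → ℤ
      outside w = δ u w * δ v w

      score : ∀ {p q} {P : U.Pred (Fin n) p} {Q : U.Pred (Fin n) q} (P? : U.Decidable P) (Q? : U.Decidable Q) →
        + length (filter (λ w → ¬? (w ≟ u) ×-dec ¬? (w ≟ v) ×-dec P? w ×-dec Q? w) (allFin n)) ≡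
        ∑ᶠ (λ w → outside w * (𝟙 (P? w) * 𝟙 (Q? w)))
      score P? Q? = trans
        (length-filter (λ w → ¬? (w ≟ u) ×-dec ¬? (w ≟ v) ×-dec P? w ×-dec Q? w) (allFin n))
        (∑-cong (allFin n) λ w → begin
          𝟙 (¬? (w ≟ u) ×-dec ¬? (w ≟ v) ×-dec P? w ×-dec Q? w)
            ≡⟨ 𝟙-× (¬? (w ≟ u)) (¬? (w ≟ v) ×-dec P? w ×-dec Q? w) ⟩
          δ w u * 𝟙 (¬? (w ≟ v) ×-dec P? w ×-dec Q? w)
            ≡⟨ cong (_*_ (δ w u)) (𝟙-× (¬? (w ≟ v)) (P? w ×-dec Q? w)) ⟩
          δ w u * (δ w v * 𝟙 (P? w ×-dec Q? w))
            ≡⟨ cong₂ (λ i j → i * (j * 𝟙 (P? w ×-dec Q? w))) (δ-sym w u) (δ-sym w v) ⟩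
          δ u w * (δ v w * 𝟙 (P? w ×-dec Q? w))
            ≡⟨ cong (λ i → δ u w * (δ v w * i)) (𝟙-× (P? w) (Q? w)) ⟩
          δ u w * (δ v w * (𝟙 (P? w) * 𝟙 (Q? w)))
            ≡⟨ *-assoc (δ u w) (δ v w) _ ⟨
          outside w * (𝟙 (P? w) * 𝟙 (Q? w)) ∎)

      α β γ ζ : Fin n → ℤ
      α w = outside w * (e u w * e v w)
      β w = outside w * (e w u * e w v)
      γ w = outside w * (e u w * e w v)
      ζ w = outside w * (e w u * e v w)

      A≡∑α : A ≡ ∑ᶠ α
      A≡∑α = score (E? u) (E? v)

      B≡∑β : B ≡ ∑ᶠ β
      B≡∑β = score (λ w → E? w u) (λ w → E? w v)

      C≡∑γ : C ≡ ∑ᶠ γ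
      C≡∑γ = score (E? u) (λ w → E? w v)

      D≡∑ζ : D ≡ ∑ᶠ ζ
      D≡∑ζ = score (λ w → E? w u) (E? v)

      -- Twice the sums and differences of `α` and `β`, and of `γ` and `ζ`, written in signs.
      -- Outside `u` and `v`, the `same` functions live on the `w` whose two signs agree, the
      -- `mixed` ones on those whose signs differ.
      same⁺ same⁻ mixed⁺ mixed⁻ : Fin n → ℤ
      same⁺  w = outside w * (1ℤ + s u w * s v w)
      same⁻  w = outside w * (s u w + s v w)
      mixed⁺ w = outside w * (1ℤ - s u w * s v w)
      mixed⁻ w = outside w * (s u w - s v w)

      2[_+_] : ∀ {X Y f g h} → X ≡ ∑ᶠ f → Y ≡ ∑ᶠ g → (∀ w → + 2 * (f w + g w) ≡ h w) → + 2 * (X + Y) ≡ ∑ᶠ h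
      2[_+_] {X} {Y} {f} {g} {h} X≡ Y≡ eq = begin
        + 2 * (X + Y)                  ≡⟨ cong₂ (λ i j → + 2 * (i + j)) X≡ Y≡ ⟩
        + 2 * (∑ᶠ f + ∑ᶠ g)            ≡⟨ cong (_*_ (+ 2)) (∑-+ (allFin n) f g) ⟨
        + 2 * ∑ᶠ (λ w → f w + g w)     ≡⟨ ∑-*ˡ (allFin n) (+ 2) _ ⟨
        ∑ᶠ (λ w → + 2 * (f w + g w))   ≡⟨ ∑-cong (allFin n) eq ⟩
        ∑ᶠ h                           ∎

      2[_-_] : ∀ {X Y f g h} → X ≡ ∑ᶠ f → Y ≡ ∑ᶠ g → (∀ w → + 2 * (f w - g w) ≡ h w) → + 2 * (X - Y) ≡ ∑ᶠ h
      2[_-_] {X} {Y} {f} {g} {h} X≡ Y≡ eq = begin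
        + 2 * (X - Y)                  ≡⟨ cong₂ (λ i j → + 2 * (i - j)) X≡ Y≡ ⟩
        + 2 * (∑ᶠ f - ∑ᶠ g)            ≡⟨ cong (_*_ (+ 2)) (∑-- (allFin n) f g) ⟨
        + 2 * ∑ᶠ (λ w → f w - g w)     ≡⟨ ∑-*ˡ (allFin n) (+ 2) _ ⟨
        ∑ᶠ (λ w → + 2 * (f w - g w))   ≡⟨ ∑-cong (allFin n) eq ⟩
        ∑ᶠ h                           ∎

      2[A+B] : + 2 * (A + B) ≡ ∑ᶠ same⁺
      2[A+B] = 2[_+_] {f = α} {g = β} A≡∑α B≡∑β λ w → decide₂
        (λ p q i p′ q′ j → + 2 * (i * j * (p * p′) + i * j * (q * q′)))
        (λ p q i p′ q′ j → i * j * (1ℤ + (p - q) * (p′ - q′)))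
        (cmp u w) (cmp v w)

      2[A-B] : + 2 * (A - B) ≡ ∑ᶠ same⁻
      2[A-B] = 2[_-_] {f = α} {g = β} A≡∑α B≡∑β λ w → decide₂
        (λ p q i p′ q′ j → + 2 * (i * j * (p * p′) - i * j * (q * q′)))
        (λ p q i p′ q′ j → i * j * ((p - q) + (p′ - q′)))
        (cmp u w) (cmp v w)

      2[C+D] : + 2 * (C + D) ≡ ∑ᶠ mixed⁺
      2[C+D] = 2[_+_] {f = γ} {g = ζ} C≡∑γ D≡∑ζ λ w → decide₂
        (λ p q i p′ q′ j → + 2 * (i * j * (p * q′) + i * j * (q * p′)))
        (λ p q i p′ q′ j → i * j * (1ℤ - (p - q) * (p′ - q′)))
        (cmp u w) (cmp v w)

      2[C-D] : + 2 * (C - D) ≡ ∑ᶠ mixed⁻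
      2[C-D] = 2[_-_] {f = γ} {g = ζ} C≡∑γ D≡∑ζ λ w → decide₂
        (λ p q i p′ q′ j → + 2 * (i * j * (p * q′) - i * j * (q * p′)))
        (λ p q i p′ q′ j → i * j * ((p - q) - (p′ - q′)))
        (cmp u w) (cmp v w)

      -- The first factor vanishes where the signs differ, the second where they agree. This is the
      -- hypothesis of `∑²*∑`.
      same⁻*mixed⁺ : ∀ w → same⁻ w * mixed⁺ w ≡ 0ℤ
      same⁻*mixed⁺ w = decide₂
        (λ p q i p′ q′ j → i * j * ((p - q) + (p′ - q′)) * (i * j * (1ℤ - (p - q) * (p′ - q′))))
        (λ _ _ _ _ _ _ → 0ℤ)
        (cmp u w) (cmp v w)

      mixed⁻*same⁺ : ∀ w → mixed⁻ w * same⁺ w ≡ 0ℤ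
      mixed⁻*same⁺ w = decide₂
        (λ p q i p′ q′ j → i * j * ((p - q) - (p′ - q′)) * (i * j * (1ℤ + (p - q) * (p′ - q′))))
        (λ _ _ _ _ _ _ → 0ℤ)
        (cmp u w) (cmp v w)

      -- Outside `u` and `v` the signs square to one. The diagonal of the squared sum thus becomes
      -- linear in `same⁺`.
      same⁻*same⁻ : ∀ w → same⁻ w * same⁻ w ≡ + 2 * same⁺ w
      same⁻*same⁻ w = decide₂
        (λ p q i p′ q′ j → i * j * ((p - q) + (p′ - q′)) * (i * j * ((p - q) + (p′ - q′))))
        (λ p q i p′ q′ j → + 2 * (i * j * (1ℤ + (p - q) * (p′ - q′))))
        (cmp u w) (cmp v w)

      mixed⁻*mixed⁻ : ∀ w → mixed⁻ w * mixed⁻ w ≡ + 2 * mixed⁺ w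
      mixed⁻*mixed⁻ w = decide₂
        (λ p q i p′ q′ j → i * j * ((p - q) - (p′ - q′)) * (i * j * ((p - q) - (p′ - q′))))
        (λ p q i p′ q′ j → + 2 * (i * j * (1ℤ - (p - q) * (p′ - q′))))
        (cmp u w) (cmp v w)

      -- The two edge sums of the theorem together are minus one eighth of the sum of `H`.
      H : ℤ
      H = (C + D) * ((A - B) ^ 2) + (A + B) * ((C - D) ^ 2) - + 2 * ((A + B) * (C + D))

      -- Doubling each of the three factors of a cubic term gives the 8. The diagonals of the two
      -- squares contribute `+ 2` times the product of the sums of `same⁺` and `mixed⁺` each, which
      -- the quadratic part of `H` cancels.
      8H : + 8 * H ≡ ∑≢ (product₃ same⁻ mixed⁺) + ∑≢ (product₃ mixed⁻ same⁺)
      8H = begin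
        + 8 * H
          ≡⟨ scale A B C D ⟩
        + 2 * (A - B) * (+ 2 * (A - B)) * (+ 2 * (C + D)) + + 2 * (C - D) * (+ 2 * (C - D)) * (+ 2 * (A + B))
          - + 4 * (+ 2 * (A + B) * (+ 2 * (C + D)))
          ≡⟨ cong₂ _-_
               (cong₂ _+_ (cong₂ _*_ (cong₂ _*_ 2[A-B] 2[A-B]) 2[C+D]) (cong₂ _*_ (cong₂ _*_ 2[C-D] 2[C-D]) 2[A+B]))
               (cong (_*_ (+ 4)) (cong₂ _*_ 2[A+B] 2[C+D])) ⟩
        ∑ᶠ same⁻ * ∑ᶠ same⁻ * ∑ᶠ mixed⁺ + ∑ᶠ mixed⁻ * ∑ᶠ mixed⁻ * ∑ᶠ same⁺ - + 4 * (∑ᶠ same⁺ * ∑ᶠ mixed⁺)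
          ≡⟨ cong (_- + 4 * (∑ᶠ same⁺ * ∑ᶠ mixed⁺)) (cong₂ _+_
               (trans (∑²*∑ same⁻ mixed⁺ same⁻*mixed⁺)
                 (cong (λ i → ∑≢ (product₃ same⁻ mixed⁺) + i * ∑ᶠ mixed⁺) (∑-double same⁻ same⁺ same⁻*same⁻)))
               (trans (∑²*∑ mixed⁻ same⁺ mixed⁻*same⁺)
                 (cong (λ i → ∑≢ (product₃ mixed⁻ same⁺) + i * ∑ᶠ same⁺) (∑-double mixed⁻ mixed⁺ mixed⁻*mixed⁻)))) ⟩
        (∑≢ (product₃ same⁻ mixed⁺) + + 2 * ∑ᶠ same⁺ * ∑ᶠ mixed⁺) +
        (∑≢ (product₃ mixed⁻ same⁺) + + 2 * ∑ᶠ mixed⁺ * ∑ᶠ same⁺) - + 4 * (∑ᶠ same⁺ * ∑ᶠ mixed⁺)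
          ≡⟨ cancel (∑≢ (product₃ same⁻ mixed⁺)) (∑≢ (product₃ mixed⁻ same⁺)) (∑ᶠ same⁺) (∑ᶠ mixed⁺) ⟩
        ∑≢ (product₃ same⁻ mixed⁺) + ∑≢ (product₃ mixed⁻ same⁺) ∎
        where
        ∑-double : ∀ f g → (∀ w → f w * f w ≡ + 2 * g w) → ∑ᶠ (λ w → f w * f w) ≡ + 2 * ∑ᶠ g
        ∑-double f g ff≡2g = trans (∑-cong (allFin n) ff≡2g) (∑-*ˡ (allFin n) (+ 2) g)

        -- The squares appear in the form to which `^ 2` unfolds.
        scale : ∀ A B C D →
          + 8 * ((C + D) * ((A - B) * ((A - B) * 1ℤ)) + (A + B) * ((C - D) * ((C - D) * 1ℤ)) - + 2 * ((A + B) * (C + D))) ≡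
          + 2 * (A - B) * (+ 2 * (A - B)) * (+ 2 * (C + D)) + + 2 * (C - D) * (+ 2 * (C - D)) * (+ 2 * (A + B))
          - + 4 * (+ 2 * (A + B) * (+ 2 * (C + D)))
        scale = solve-∀

        cancel : ∀ i j k l → (i + + 2 * k * l) + (j + + 2 * l * k) - + 4 * (k * l) ≡ i + j
        cancel = solve-∀

    open Edge using (A; B; C; D; H; outside; same⁺; same⁻; mixed⁺; mixed⁻; 8H)

    -- Half the combined summand of `8H`, stripped of its `outside` factors.
    bracket : Vec (Fin n) 5 → ℤ
    bracket (u ∷ v ∷ x ∷ y ∷ z ∷ []) =
      s u x * s u y + s v x * s v y - s u z * s v z * (s u x * s v y + s v x * s u y)

    -- The factor `δ u v`, the `outside` factors of the three vertices and the distinctness of the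
    -- triple multiply to the distinctness of all five vertices.
    δ*8H : ∀ u v → δ u v * (+ 8 * H u v) ≡ ∑ⁿ 3 (λ t → distinct (u ∷ v ∷ t) * (+ 2 * bracket (u ∷ v ∷ t)))
    δ*8H u v = begin
      δ u v * (+ 8 * H u v)
        ≡⟨ cong (_*_ (δ u v)) (8H u v) ⟩
      δ u v * (∑≢ f + ∑≢ g)
        ≡⟨ cong (_*_ (δ u v)) (∑≢-+ f g) ⟨
      δ u v * ∑≢ (λ t → f t + g t)
        ≡⟨ cong (_*_ (δ u v)) (∑≢-def (λ t → f t + g t)) ⟩
      δ u v * ∑ⁿ 3 (λ t → distinct t * (f t + g t))
        ≡⟨ ∑ⁿ-*ˡ 3 (δ u v) (λ t → distinct t * (f t + g t)) ⟨
      ∑ⁿ 3 (λ t → δ u v * (distinct t * (f t + g t)))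
        ≡⟨ ∑ⁿ-cong 3 pointwise ⟩
      ∑ⁿ 3 (λ t → distinct (u ∷ v ∷ t) * (+ 2 * bracket (u ∷ v ∷ t))) ∎
      where
      f g : Vec (Fin n) 3 → ℤ
      f = product₃ (same⁻ u v) (mixed⁺ u v)
      g = product₃ (mixed⁻ u v) (same⁺ u v)

      expand : ∀ i j k a₁ a₂ a₃ b₁ b₂ b₃ →
        i * (a₁ + b₁) * (j * (a₂ + b₂)) * (k * (1ℤ - a₃ * b₃)) +
        i * (a₁ - b₁) * (j * (a₂ - b₂)) * (k * (1ℤ + a₃ * b₃)) ≡
        i * j * k * (+ 2 * (a₁ * a₂ + b₁ * b₂ - a₃ * b₃ * (a₁ * b₂ + b₁ * a₂)))
      expand = solve-∀

      regroup : ∀ d t i₁ i₂ i₃ j₁ j₂ j₃ b →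
        d * (t * (i₁ * j₁ * (i₂ * j₂) * (i₃ * j₃) * b)) ≡
        d * (i₁ * (i₂ * (i₃ * 1ℤ))) * (j₁ * (j₂ * (j₃ * 1ℤ)) * t) * b
      regroup = solve-∀

      pointwise : ∀ t → δ u v * (distinct t * (f t + g t)) ≡ distinct (u ∷ v ∷ t) * (+ 2 * bracket (u ∷ v ∷ t))
      pointwise t@(x ∷ y ∷ z ∷ []) = trans
        (cong (λ i → δ u v * (distinct t * i))
          (expand (outside u v x) (outside u v y) (outside u v z) (s u x) (s u y) (s u z) (s v x) (s v y) (s v z)))
        (regroup (δ u v) (distinct t) (δ u x) (δ u y) (δ u z) (δ v x) (δ v y) (δ v z) (+ 2 * bracket (u ∷ v ∷ t)))

    -- Up to exchanging `u` and `v`, the terms are of two kinds. `k₁` follows the path `x`, `u`, `y`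
    -- with one sign reversed and gives minus `path₂`; `k₂` follows `x`, `u`, `z`, `v`, `y` with two
    -- signs reversed and gives `path₄`.
    ∑≢-bracket : ∑≢ bracket ≡ - (+ 2 * (∑≢ path₂ + ∑≢ path₄))
    ∑≢-bracket = begin
      ∑≢ bracket
        ≡⟨ ∑≢-cong (λ v _ → split v) ⟩
      ∑≢ (λ v → (k₁ v + k₁ (act swap v)) + -1ℤ * (k₂ v + k₂ (act swap v)))
        ≡⟨ ∑≢-+ (λ v → k₁ v + k₁ (act swap v)) (λ v → -1ℤ * (k₂ v + k₂ (act swap v))) ⟩
      ∑≢ (λ v → k₁ v + k₁ (act swap v)) + ∑≢ (λ v → -1ℤ * (k₂ v + k₂ (act swap v)))
        ≡⟨ cong₂ _+_ (∑≢-symmetrise k₁)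
             (trans (∑≢-*ˡ -1ℤ (λ v → k₂ v + k₂ (act swap v))) (cong (_*_ -1ℤ) (∑≢-symmetrise k₂))) ⟩
      (∑≢ k₁ + ∑≢ k₁) + -1ℤ * (∑≢ k₂ + ∑≢ k₂)
        ≡⟨ cong₂ (λ i j → (i + i) + -1ℤ * (j + j)) ∑≢-k₁ ∑≢-k₂ ⟩
      (-1ℤ * ∑≢ path₂ + -1ℤ * ∑≢ path₂) + -1ℤ * (∑≢ path₄ + ∑≢ path₄)
        ≡⟨ collect (∑≢ path₂) (∑≢ path₄) ⟩
      - (+ 2 * (∑≢ path₂ + ∑≢ path₄)) ∎
      where
      k₁ k₂ : Vec (Fin n) 5 → ℤ
      k₁ (u ∷ v ∷ x ∷ y ∷ z ∷ []) = s u x * s u y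
      k₂ (u ∷ v ∷ x ∷ y ∷ z ∷ []) = s u x * s u z * (s v z * s v y)

      -- These arrange (u , v , x , y , z) as (x , u , y , v , z) and (x , u , z , v , y).
      π₁ π₂ : Perm 5
      π₁ = skip swap ⨾ swap ⨾ skip (skip swap)
      π₂ = skip swap ⨾ swap ⨾ skip (skip (skip swap)) ⨾ skip (skip swap)

      ∑≢-symmetrise : ∀ f → ∑≢ (λ v → f v + f (act swap v)) ≡ ∑≢ f + ∑≢ f
      ∑≢-symmetrise f = trans (∑≢-+ f (f ∘ act swap)) (cong (_+_ (∑≢ f)) (∑≢-act swap f))

      collect : ∀ i j → (-1ℤ * i + -1ℤ * i) + -1ℤ * (j + j) ≡ - (+ 2 * (i + j))
      collect = solve-∀

      split : ∀ v → bracket v ≡ (k₁ v + k₁ (act swap v)) + -1ℤ * (k₂ v + k₂ (act swap v))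
      split (u ∷ v ∷ x ∷ y ∷ z ∷ []) = regroup (s u x) (s u y) (s u z) (s v x) (s v y) (s v z)
        where
        regroup : ∀ a₁ a₂ a₃ b₁ b₂ b₃ → a₁ * a₂ + b₁ * b₂ - a₃ * b₃ * (a₁ * b₂ + b₁ * a₂) ≡
                  (a₁ * a₂ + b₁ * b₂) + -1ℤ * (a₁ * a₃ * (b₃ * b₂) + b₁ * b₃ * (a₃ * a₂))
        regroup = solve-∀

      k₁≡ : ∀ v → k₁ v ≡ -1ℤ * path₂ (act π₁ v)
      k₁≡ (u ∷ v ∷ x ∷ y ∷ z ∷ []) = trans (cong (_* s u y) (s-antisym x u)) (regroup (s x u) (s u y))
        where
        regroup : ∀ i j → - i * j ≡ -1ℤ * (i * j)
        regroup = solve-∀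

      k₂≡ : ∀ v → k₂ v ≡ path₄ (act π₂ v)
      k₂≡ (u ∷ v ∷ x ∷ y ∷ z ∷ []) = trans
        (cong₂ (λ i j → i * s u z * (j * s v y)) (s-antisym x u) (s-antisym z v))
        (regroup (s x u) (s u z) (s z v) (s v y))
        where
        regroup : ∀ i j k l → - i * j * (- k * l) ≡ i * j * (k * l)
        regroup = solve-∀

      ∑≢-k₁ : ∑≢ k₁ ≡ -1ℤ * ∑≢ path₂
      ∑≢-k₁ = trans (∑≢-cong (λ v _ → k₁≡ v))
        (trans (∑≢-*ˡ -1ℤ (path₂ ∘ act π₁)) (cong (_*_ -1ℤ) (∑≢-act π₁ path₂)))

      ∑≢-k₂ : ∑≢ k₂ ≡ ∑≢ path₄
      ∑≢-k₂ = trans (∑≢-cong (λ v _ → k₂≡ v)) (∑≢-act π₂ path₄)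

    -- Sums over edges

    ∑edges≡∑∑ : ∀ f → ∑edges T f ≡ ∑ᶠ (λ u → ∑ᶠ (λ v → e u v * f u v))
    ∑edges≡∑∑ f = trans
      (∑-filter (uncurry E?) (cartesianProduct (allFin n) (allFin n)) (uncurry f))
      (∑-cartesianProductWith _,_ (allFin n) (allFin n) (λ uv → 𝟙 (uncurry E? uv) * uncurry f uv))

    -- For symmetric `f` the orientation can be averaged out: the indicators of the two directions
    -- add up to `δ u v`.
    2*∑edges : ∀ f → (∀ u v → f v u ≡ f u v) → + 2 * ∑edges T f ≡ ∑ᶠ (λ u → ∑ᶠ (λ v → δ u v * f u v))
    2*∑edges f f-sym = begin
      + 2 * ∑edges T f
        ≡⟨ cong (_*_ (+ 2)) (∑edges≡∑∑ f) ⟩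
      + 2 * F
        ≡⟨ double F ⟩
      F + F
        ≡⟨ cong (_+_ F) (∑-swap (allFin n) (allFin n) (λ u v → e u v * f u v)) ⟩
      F + ∑ᶠ (λ u → ∑ᶠ (λ v → e v u * f v u))
        ≡⟨ ∑-+ (allFin n) _ _ ⟨
      ∑ᶠ (λ u → ∑ᶠ (λ v → e u v * f u v) + ∑ᶠ (λ v → e v u * f v u))
        ≡⟨ ∑-cong (allFin n) (λ u → ∑-+ (allFin n) _ _) ⟨
      ∑ᶠ (λ u → ∑ᶠ (λ v → e u v * f u v + e v u * f v u))
        ≡⟨ ∑-cong (allFin n) (λ u → ∑-cong (allFin n) λ v → merge u v) ⟩
      ∑ᶠ (λ u → ∑ᶠ (λ v → δ u v * f u v)) ∎
      where
      F : ℤ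
      F = ∑ᶠ (λ u → ∑ᶠ (λ v → e u v * f u v))

      merge : ∀ u v → e u v * f u v + e v u * f v u ≡ δ u v * f u v
      merge u v = begin
        e u v * f u v + e v u * f v u  ≡⟨ cong (λ i → e u v * f u v + e v u * i) (f-sym u v) ⟩
        e u v * f u v + e v u * f u v  ≡⟨ *-distribʳ-+ (f u v) (e u v) (e v u) ⟨
        (e u v + e v u) * f u v        ≡⟨ cong (_* f u v) (e+e≡δ u v) ⟩
        δ u v * f u v                  ∎

    -- Exchanging `u` and `v` preserves `A` and `B` and exchanges `C` and `D`, in which `H` is
    -- symmetric.
    H-sym : ∀ u v → H v u ≡ H u v
    H-sym u v = trans (cong₂ (λ i j → polynomial i j (C v u) (D v u)) A-sym B-sym)
      (trans (cong₂ (λ i j → polynomial (A u v) (B u v) i j) C-swap D-swap)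
        (swap-CD (A u v) (B u v) (C u v) (D u v)))
      where
      polynomial : ℤ → ℤ → ℤ → ℤ → ℤ
      polynomial A B C D = (C + D) * ((A - B) ^ 2) + (A + B) * ((C - D) ^ 2) - + 2 * ((A + B) * (C + D))

      swap-CD : ∀ A B C D →
        (D + C) * ((A - B) * ((A - B) * 1ℤ)) + (A + B) * ((D - C) * ((D - C) * 1ℤ)) - + 2 * ((A + B) * (D + C)) ≡
        (C + D) * ((A - B) * ((A - B) * 1ℤ)) + (A + B) * ((C - D) * ((C - D) * 1ℤ)) - + 2 * ((A + B) * (C + D))
      swap-CD = solve-∀

      exchange : ∀ i j p q → j * i * (q * p) ≡ i * j * (p * q)
      exchange = solve-∀

      A-sym : A v u ≡ A u v
      A-sym = trans (Edge.A≡∑α v u) (trans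
        (∑-cong (allFin n) λ w → exchange (δ u w) (δ v w) (e u w) (e v w)) (sym (Edge.A≡∑α u v)))

      B-sym : B v u ≡ B u v
      B-sym = trans (Edge.B≡∑β v u) (trans
        (∑-cong (allFin n) λ w → exchange (δ u w) (δ v w) (e w u) (e w v)) (sym (Edge.B≡∑β u v)))

      C-swap : C v u ≡ D u v
      C-swap = trans (Edge.C≡∑γ v u) (trans
        (∑-cong (allFin n) λ w → exchange (δ u w) (δ v w) (e w u) (e v w)) (sym (Edge.D≡∑ζ u v)))

      D-swap : D v u ≡ C u v
      D-swap = trans (Edge.D≡∑ζ v u) (trans
        (∑-cong (allFin n) λ w → exchange (δ u w) (δ v w) (e u w) (e w v)) (sym (Edge.C≡∑γ u v)))

    -- The 16 is the 8 of `8H` times the 2 of `2*∑edges`.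
    16*∑edges-H : + 16 * ∑edges T H ≡ - (+ 4 * (∑≢ path₂ + ∑≢ path₄))
    16*∑edges-H = begin
      + 16 * ∑edges T H
        ≡⟨ *-assoc (+ 8) (+ 2) (∑edges T H) ⟩
      + 8 * (+ 2 * ∑edges T H)
        ≡⟨ cong (_*_ (+ 8)) (2*∑edges H H-sym) ⟩
      + 8 * ∑ᶠ (λ u → ∑ᶠ (λ v → δ u v * H u v))
        ≡⟨ ∑-*ˡ (allFin n) (+ 8) _ ⟨
      ∑ᶠ (λ u → + 8 * ∑ᶠ (λ v → δ u v * H u v))
        ≡⟨ ∑-cong (allFin n) (λ u → ∑-*ˡ (allFin n) (+ 8) _) ⟨
      ∑ᶠ (λ u → ∑ᶠ (λ v → + 8 * (δ u v * H u v)))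
        ≡⟨ ∑-cong (allFin n) (λ u → ∑-cong (allFin n) λ v →
             trans (*-exchange (+ 8) (δ u v) (H u v)) (δ*8H u v)) ⟩
      -- The sums over `u` and `v` around `∑ⁿ 3` are `∑ⁿ 5` by definition.
      ∑ⁿ 5 (λ v → distinct v * (+ 2 * bracket v))
        ≡⟨ ∑≢-def (λ v → + 2 * bracket v) ⟨
      ∑≢ (λ v → + 2 * bracket v)
        ≡⟨ ∑≢-*ˡ (+ 2) bracket ⟩
      + 2 * ∑≢ bracket
        ≡⟨ cong (_*_ (+ 2)) ∑≢-bracket ⟩
      + 2 * - (+ 2 * (∑≢ path₂ + ∑≢ path₄))
        ≡⟨ collect (∑≢ path₂ + ∑≢ path₄) ⟩
      - (+ 4 * (∑≢ path₂ + ∑≢ path₄)) ∎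
      where
      collect : ∀ i → + 2 * - (+ 2 * i) ≡ - (+ 4 * i)
      collect = solve-∀

    cubic quadratic : Fin n → Fin n → ℤ
    cubic     u v = (C u v + D u v) * ((A u v - B u v) ^ 2) + (A u v + B u v) * ((C u v - D u v) ^ 2)
    quadratic u v = (A u v + B u v) * (C u v + D u v)

    -- The sum of the two path terms is eliminated between `160*c-5`, taken 4 times, and
    -- `16*∑edges-H`, taken 5 times; all coefficients are then divisible by 80.
    8*c-5 : + 8 * + Defs.c T 5 ≡ + 6 * + (n choose 5) - ∑edges T cubic + + 2 * ∑edges T quadratic
    8*c-5 = *-cancelˡ-≡ (+ 80) (+ 8 * + Defs.c T 5) (+ 6 * + (n choose 5) - G₃ + + 2 * G₂) (begin
      + 80 * (+ 8 * c₅)                                   ≡⟨ regroup₁ c₅ ⟩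
      + 4 * (+ 160 * c₅)                                  ≡⟨ cong (_*_ (+ 4)) (Cycles.160*c-5 T) ⟩
      + 4 * (+ 120 * N + + 5 * (∑≢ path₂ + ∑≢ path₄))     ≡⟨ regroup₂ N (∑≢ path₂ + ∑≢ path₄) ⟩
      + 480 * N - + 5 * - (+ 4 * (∑≢ path₂ + ∑≢ path₄))   ≡⟨ cong (λ i → + 480 * N - + 5 * i) 16*∑edges-H ⟨
      + 480 * N - + 5 * (+ 16 * ∑edges T H)               ≡⟨ cong (λ i → + 480 * N - + 5 * (+ 16 * i)) ∑edges-H ⟩
      + 480 * N - + 5 * (+ 16 * (G₃ - + 2 * G₂))          ≡⟨ regroup₃ N G₃ G₂ ⟩
      + 80 * (+ 6 * N - G₃ + + 2 * G₂)                    ∎)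
      where
      c₅ N G₃ G₂ : ℤ
      c₅ = + Defs.c T 5
      N  = + (n choose 5)
      G₃ = ∑edges T cubic
      G₂ = ∑edges T quadratic

      ∑edges-H : ∑edges T H ≡ G₃ - + 2 * G₂
      ∑edges-H = trans (∑-- (edges T) (uncurry cubic) (λ uv → + 2 * uncurry quadratic uv))
        (cong (_-_ G₃) (∑-*ˡ (edges T) (+ 2) (uncurry quadratic)))

      regroup₁ : ∀ i → + 80 * (+ 8 * i) ≡ + 4 * (+ 160 * i)
      regroup₁ = solve-∀

      regroup₂ : ∀ i j → + 4 * (+ 120 * i + + 5 * j) ≡ + 480 * i - + 5 * - (+ 4 * j)
      regroup₂ = solve-∀

      regroup₃ : ∀ i j k → + 480 * i - + 5 * (+ 16 * (j - + 2 * k)) ≡ + 80 * (+ 6 * i - j + + 2 * k)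
      regroup₃ = solve-∀

  -- Passage from integers to rationals

  fractions : ∀ c N G₃ G₂ → + 8 * c ≡ + 6 * N - G₃ + + 2 * G₂ →
    c / 1 ≡ (+ 3) / 4 ℚ.* (N / 1) ℚ.- (+ 1) / 8 ℚ.* (G₃ / 1) ℚ.+ (+ 1) / 4 ℚ.* (G₂ / 1)
  -- Among unnormalised rationals equality is cross multiplication, so the claim reduces to the
  -- integer equation `cross`.
  fractions c N G₃ G₂ eq = toℚᵘ-injective (≃-trans (toℚᵘ-/1 c) (≃-sym (≃-trans
    (≃-trans (toℚᵘ-homo-+ (p ℚ.- q) r) (ℚᵘ.+-cong
      (≃-trans (toℚᵘ-homo-+ p (ℚ.- q)) (ℚᵘ.+-cong (product (+ 3 / 4) N)
        (≃-trans (toℚᵘ-homo‿- q) (ℚᵘ.-‿cong (product (+ 1 / 8) G₃)))))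
      (product (+ 1 / 4) G₂)))
    (*≡* cross))))
    where
    p q r : ℚ.ℚ
    p = (+ 3) / 4 ℚ.* (N / 1)
    q = (+ 1) / 8 ℚ.* (G₃ / 1)
    r = (+ 1) / 4 ℚ.* (G₂ / 1)

    toℚᵘ-/1 : ∀ i → toℚᵘ (i / 1) ≃ mkℚᵘ i 0
    toℚᵘ-/1 i = toℚᵘ-fromℚᵘ (mkℚᵘ i 0)

    product : ∀ x i → toℚᵘ (x ℚ.* (i / 1)) ≃ toℚᵘ x ℚᵘ.* mkℚᵘ i 0
    product x i = ≃-trans (toℚᵘ-homo-* x (i / 1)) (ℚᵘ.*-congˡ {toℚᵘ x} (toℚᵘ-/1 i))

    regroup : ∀ i j k → (((+ 3 * i) * + 8 + - (1ℤ * j) * + 4) * + 4 + (1ℤ * k) * + 32) * 1ℤ ≡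
              + 16 * (+ 6 * i - j + + 2 * k)
    regroup = solve-∀

    rescale : ∀ i → + 16 * (+ 8 * i) ≡ i * + 128
    rescale = solve-∀

    -- Here 128 is the product of the denominators 4, 8 and 4, and 32 that of the first two.
    cross : (((+ 3 * N) * + 8 + - (1ℤ * G₃) * + 4) * + 4 + (1ℤ * G₂) * + 32) * 1ℤ ≡ c * + 128
    cross = trans (regroup N G₃ G₂) (trans (cong (_*_ (+ 16)) (sym eq)) (rescale c))

open import Data.Rational.Base using (_+_; _-_; _*_)

theorem2p1 : ∀ (n : ℕ) (T : Tournament n) →
  (+ c T 5) / 1 ≡
    ((+ 3) / 4) * ((+ (n choose 5)) / 1)
    - ((+ 1) / 8) * (∑edges T (λ u v →
        let A = + scoreA T u v
            B = + scoreB T u v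
            C = + scoreC T u v
            D = + scoreD T u v
        in ((C +ℤ D) *ℤ ((A -ℤ B) ^ 2)) +ℤ ((A +ℤ B) *ℤ ((C -ℤ D) ^ 2))) / 1)
    + ((+ 1) / 4) * (∑edges T (λ u v →
        let A = + scoreA T u v
            B = + scoreB T u v
            C = + scoreC T u v
            D = + scoreD T u v
        in (A +ℤ B) *ℤ (C +ℤ D)) / 1)
theorem2p1 n T =
  fractions (+ c T 5) (+ (n choose 5)) (∑edges T cubic) (∑edges T quadratic) 8*c-5
  where
  open IntegerIdentity
  open Scores T
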